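{- For every integer $v>1$ for which a $(K_v,P_4)$-design exists, \[\mathcal{L}_1P_4(v)=\{n\geq v-1\mid n\equiv 0,1\pmod 4\},\] \[\mathcal{L}_2P_4(v)\subseteq\{n\geq v\mid n\equiv 0,1\pmod 4\}.\]
   Context: All graphs are finite and simple; $\Gamma\leq K$ means $\Gamma$ is a subgraph of $K$ (or is isomorphic to one, when $\Gamma$ is an abstract graph). $P_k$ is the path on $k$ vertices. For a graph $K$ and $\Gamma\leq K$, a $(K,\Gamma)$-design is a set $\mathcal{B}$ of subgraphs of $K$, called blocks, each isomorphic to $\Gamma$, whose edge-sets partition $E(K)$. $K_n$ is the complete graph on a set of $n$ vertices (any $n$-element vertex set may be used); a $\Gamma$-design of order $n$ is a $(K_n,\Gamma)$-design. Given $\Gamma'\leq\Gamma$, a $(K,\Gamma)$-design $\mathcal{B}$ and a $(K',\Gamma')$-design $\mathcal{B}'$, a down-link from $\mathcal{B}$ to $\mathcal{B}'$ is a function $f:\mathcal{B}\to\mathcal{B}'$ such that $f(B)$ is a subgraph of $B$ for every $B\in\mathcal{B}$ (the vertex sets of $K$ and $K'$ need not coincide, and either may be the larger). Take $\Gamma'=P_3$. For $v$ such that a $(K_v,\Gamma)$-design exists: $\mathcal{L}_1\Gamma(v)$ is the set of all integers $n$ such that some $\Gamma$-design of order $v$ can be down-linked to a $P_3$-design of order $n$; $\mathcal{L}_2\Gamma(v)$ is the set of all integers $n$ such that every $\Gamma$-design of order $v$ can be down-linked to a $P_3$-design of order $n$. A $(K_v,P_k)$-design exists if and only if $v\geq k$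 and $v(v-1)\equiv 0\pmod{2(k-1)}$. -}

module Defs where

open import Data.Fin.Base using (Fin)
open import Data.List.Base using (List; length; upTo)
open import Data.List.Membership.Propositional using (_∈_)
open import Data.List.Membership.Propositional.Properties using (∈-upTo⁺)
open import Data.List.Membership.DecPropositional using (_∈?_)
open import Data.List.Relation.Unary.Unique.Propositional using (Unique)
open import Data.List.Relation.Unary.Unique.Propositional.Properties using (upTo⁺)
open import Data.Nat.Base using (ℕ; suc; _<_)
open import Data.Nat.Properties using (_≟_; _<?_; 1+n≢n)
open import Data.Product using (Σ-syntax; ∃!; _×_; _,_; proj₁)
open import Data.Sum.Base using (_⊎_; inj₁; inj₂; swap)
open import Function.Bundles using (_↔_; _⇔_; Inverse)
open import Level using (0ℓ) renaming (suc to lsuc)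
open import Relation.Binary.Core using (Rel)
open import Relation.Binary.Definitions using (Decidable; Symmetric; Irreflexive)
open import Relation.Binary.PropositionalEquality.Core using (_≡_; _≢_; refl; ≢-sym)
open import Relation.Nullary.Decidable using (_×-dec_; _⊎-dec_; ¬?)
open import Relation.Unary using (Pred)

-- Vertices are drawn from the infinite label set ℕ, so that the vertex sets of
-- different graphs can be compared and may overlap arbitrarily.
record VertexSet : Set where
  field
    elements : List ℕ
    unique   : Unique elements

  order : ℕ
  order = length elements

record Graph : Set₁ where
  infix 4 _~_
  field
    vertexSet : VertexSet
    _~_       : Rel ℕ 0ℓ

  open VertexSet vertexSet public renaming (elements to vertices)

  field
    ~-dec    : Decidable _~_
    ~-sym    : Symmetric _~_
    ~-irrefl : Irreflexive _≡_ _~_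
    incident : ∀ {x y} → x ~ y → x ∈ vertices

  -- As `vertices` has no repetitions, proofs of membership in it are unique,
  -- so this type has exactly one inhabitant for each vertex.
  Vertex : Set
  Vertex = Σ[ x ∈ ℕ ] x ∈ vertices

open Graph using (vertices; Vertex)

infix 4 _≤ᴳ_ _≅ᴳ_

_≤ᴳ_ : Graph → Graph → Set
G ≤ᴳ H = (∀ {x} → x ∈ vertices G → x ∈ vertices H)
       × (∀ {x y} → x G.~ y → x H.~ y)
  where
    module G = Graph G
    module H = Graph H

_≅ᴳ_ : Graph → Graph → Set
G ≅ᴳ H = Σ[ φ ∈ Vertex G ↔ Vertex H ]
         (∀ u w → (proj₁ u G.~ proj₁ w) ⇔
                  (proj₁ (Inverse.to φ u) H.~ proj₁ (Inverse.to φ w)))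
  where
    module G = Graph G
    module H = Graph H

K : VertexSet → Graph
K X = record
  { vertexSet = X
  ; _~_       = λ x y → x ∈ X.elements × y ∈ X.elements × x ≢ y
  ; ~-dec     = λ x y → _∈?_ _≟_ x X.elements ×-dec _∈?_ _≟_ y X.elements ×-dec ¬? (x ≟ y)
  ; ~-sym     = λ (p , q , x≢y) → q , p , ≢-sym x≢y
  ; ~-irrefl  = λ x≡y (_ , _ , x≢y) → x≢y x≡y
  ; incident  = proj₁
  }
  where module X = VertexSet X

-- The path 0 — 1 — ⋯ — (k − 1); k counts vertices, not edges.
P : ℕ → Graph
P k = record
  { vertexSet = record { elements = upTo k ; unique = upTo⁺ k }
  ; _~_       = λ i j → i < k × j < k × (suc i ≡ j ⊎ suc j ≡ i)
  ; ~-dec     = λ i j → (i <? k) ×-dec (j <? k) ×-dec ((suc i ≟ j) ⊎-dec (suc j ≟ i))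
  ; ~-sym     = λ (p , q , r) → q , p , swap r
  ; ~-irrefl  = λ { refl (_ , _ , inj₁ e) → 1+n≢n e
                  ; refl (_ , _ , inj₂ e) → 1+n≢n e }
  ; incident  = λ (p , _) → ∈-upTo⁺ p
  }

-- The set of blocks is given as an indexed family.  By `partition`, blocks at
-- different indices share no edge, so they are distinct whenever Γ has an edge.
record Design (K Γ : Graph) : Set₁ where
  private module K = Graph K
  field
    size       : ℕ
    block      : Fin size → Graph
    subgraph   : ∀ i → block i ≤ᴳ K
    isomorphic : ∀ i → block i ≅ᴳ Γ
    partition  : ∀ {x y} → x K.~ y → ∃! _≡_ λ i → Graph._~_ (block i) x y

record DesignOfOrder (Γ : Graph) (n : ℕ) : Set₁ where
  field
    vertexSet : VertexSet
    order≡n   : VertexSet.order vertexSet ≡ n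
    design    : Design (K vertexSet) Γ

  open Design design public

DownLink : ∀ {K Γ K′ Γ′} → Design K Γ → Design K′ Γ′ → Set
DownLink B B′ = Σ[ f ∈ (Fin B.size → Fin B′.size) ] ∀ i → B′.block (f i) ≤ᴳ B.block i
  where
    module B  = Design B
    module B′ = Design B′

𝓛₁ : Graph → ℕ → Pred ℕ (lsuc 0ℓ)
𝓛₁ Γ v n = Σ[ B ∈ DesignOfOrder Γ v ] Σ[ B′ ∈ DesignOfOrder (P 3) n ]
           DownLink (DesignOfOrder.design B) (DesignOfOrder.design B′)

𝓛₂ : Graph → ℕ → Pred ℕ (lsuc 0ℓ)
𝓛₂ Γ v n = (B : DesignOfOrder Γ v) → Σ[ B′ ∈ DesignOfOrder (P 3) n ]
           DownLink (DesignOfOrder.design B) (DesignOfOrder.design B′)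

{-# OPTIONS --safe #-}
module Submission where

-- Write each P₄ of a design as a P₃ followed by a last edge; a down-link to a P₃-design of order n
-- exists as soon as the initial P₃s extend to a P₃-decomposition of K_n.  If n > v, the last edges and
-- the new edges of K_n form a graph with a dominating vertex w: assign every edge not at w to its first
-- endpoint, correct odd vertices u with the edge wu, and pair up the edges assigned to each vertex; the
-- parity at w is right because n ≡ 0, 1 (mod 4) makes the number of edges even.  The orders n = v and
-- n = v − 1 are reached by adding twelve vertices N at a time: the edges meeting N are split into an
-- explicit piece on N and at most two old vertices, and copies of K_{2,12} on N and pairs of old vertices.
--
-- Conversely, any P₃ inside a P₄ contains both inner vertices.  Hence at most one vertex of K_v is
-- missing from K_n, and none is missing if every vertex is an inner vertex of some block; the same
-- recursion provides such designs, which excludes n = v − 1 from 𝓛₂.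

open import Defs
open import Data.Nat.Base using (ℕ; _<_; _≥_; _∸_)
open import Data.Nat.DivMod using (_%_)
open import Data.Product.Base using (_×_)
open import Data.Sum.Base using (_⊎_)
open import Relation.Binary.PropositionalEquality using (_≡_)
open import Relation.Unary using (_≐_; _⊆_)

open import Algebra.Bundles using (CommutativeMonoid)
open import Data.Bool.Base using (if_then_else_; true; false)
open import Data.Empty using (⊥-elim)
open import Data.Fin.Base using (Fin; zero; suc; toℕ; fromℕ<; inject₁)
open import Data.Fin.Patterns using (0F; 1F; 2F)
open import Data.Fin.Properties as Fin
  using (toℕ<n; toℕ-injective; toℕ-fromℕ<; toℕ-inject₁; injective⇒≤)
open import Data.List.Base as List
  using (List; []; _∷_; _++_; map; concatMap; cartesianProduct; tabulate; length)
open import Data.List.Properties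
  using (++-assoc; ++-identityʳ; map-++; map-id; map-∘; map-cong; concatMap-++; length-++; length-map;
         cartesianProductWith-distribʳ-++)
open import Data.List.Membership.Propositional using (_∈_; _∉_; find)
open import Data.List.Membership.Propositional.Properties
open import Data.List.Membership.Propositional.Properties.WithK using (unique⇒irrelevant)
open import Data.List.Membership.DecPropositional using (_∈?_)
open import Data.List.Relation.Unary.All as All using (All; []; _∷_)
import Data.List.Relation.Unary.All.Properties as AllP
open import Data.List.Relation.Unary.AllPairs using ([]; _∷_)
open import Data.List.Relation.Unary.Any using (here; there; index)
open import Data.List.Relation.Unary.Any.Properties using (lookup-index)
import Data.List.Relation.Unary.Unique.Propositional as ListUnique
import Data.List.Relation.Unary.Unique.Propositional.Properties as ListUniqueP
open import Data.Nat.Base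
open import Data.Nat.DivMod using ([m+kn]%n≡m%n; m*n%n≡0)
open import Data.Nat.ListAction using (sum)
open import Data.Nat.Properties
open import Data.Nat.Solver using (module +-*-Solver)
open import Data.Product using (∃!)
open import Data.Product.Base as Product using (Σ-syntax; ∃; ∃₂; _,_; proj₁; proj₂)
open import Data.Product.Properties using (≡-dec)
open import Data.Sum.Base as Sum using (inj₁; inj₂; swap)
open import Data.Vec.Base as Vec using (Vec; []; _∷_; lookup)
open import Data.Vec.Properties using (lookup∘tabulate)
open import Data.Vec.Relation.Unary.All using ([]; _∷_)
import Data.Vec.Relation.Unary.All.Properties as VecAllP
open import Data.Vec.Relation.Unary.AllPairs using (allPairs?; []; _∷_)
open import Data.Vec.Relation.Unary.Unique.Propositional using (Unique)
import Data.Vec.Relation.Unary.Unique.Propositional.Properties as UniqueP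
open import Function.Base using (_∘_; id)
open import Function.Bundles using (Inverse; Equivalence; mk↔ₛ′; mk⇔)
open import Relation.Binary.Definitions using (tri<; tri≈; tri>)
open import Relation.Binary.PropositionalEquality
open import Relation.Nullary using (Dec; does; yes; no; ¬_)
open import Relation.Nullary.Decidable
  using (¬?; _→-dec_; _⊎-dec_; dec-true; dec-false; from-yes; True; toWitness)

open +-*-Solver using (_:+_; _:*_; _:=_; con) renaming (solve to ℕ-solve)

-- Edge lists up to order and orientation

Edge : Set
Edge = ℕ × ℕ

Path : ℕ → Set
Path = Vec ℕ

path₃ : ℕ → ℕ → ℕ → Path 3
path₃ a b c = a ∷ b ∷ c ∷ []

path₄ : ℕ → ℕ → ℕ → ℕ → Path 4
path₄ a b c d = a ∷ b ∷ c ∷ d ∷ []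

private variable
  k m n o s v x y : ℕ
  E F E′ F′ : List Edge

δ : ℕ → ℕ → ℕ
δ p x = if does (p ≟ x) then 1 else 0

-- Both orders of the ends count, which makes edges undirected; symmetry is then commutativity of
-- the arithmetic. A loop counts twice at its own end, so that every edge contributes exactly 2 to a
-- sum over all ordered pairs, and the products let such sums factor.
hit : Edge → ℕ → ℕ → ℕ
hit (p , q) x y = δ p x * δ q y + δ p y * δ q x

mult : List Edge → ℕ → ℕ → ℕ
mult []      x y = 0
mult (e ∷ E) x y = hit e x y + mult E x y

mult-++ : ∀ E F x y → mult (E ++ F) x y ≡ mult E x y + mult F x y
mult-++ []      F x y = refl
mult-++ (e ∷ E) F x y =
  trans (cong (hit e x y +_) (mult-++ E F x y)) (sym (+-assoc (hit e x y) _ _))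

-- A record, so that the two edge lists can be inferred from the relation.
infix 4 _≋_
record _≋_ (E F : List Edge) : Set where
  constructor mk≋
  field at : ∀ x y → mult E x y ≡ mult F x y

open _≋_

≋-refl : E ≋ E
≋-refl = mk≋ λ _ _ → refl

≋-reflexive : E ≡ F → E ≋ F
≋-reflexive refl = ≋-refl

≋-sym : E ≋ F → F ≋ E
≋-sym p = mk≋ λ x y → sym (at p x y)

≋-trans : E ≋ F → F ≋ E′ → E ≋ E′
≋-trans p q = mk≋ λ x y → trans (at p x y) (at q x y)

++-cong : E ≋ F → E′ ≋ F′ → E ++ E′ ≋ F ++ F′
++-cong {E} {F} {E′} {F′} p q = mk≋ λ x y →
  trans (mult-++ E E′ x y) (trans (cong₂ _+_ (at p x y) (at q x y)) (sym (mult-++ F F′ x y)))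

++-comm : ∀ E F → E ++ F ≋ F ++ E
++-comm E F = mk≋ λ x y →
  trans (mult-++ E F x y) (trans (+-comm (mult E x y) _) (sym (mult-++ F E x y)))

flip-≋ : ∀ p q → (p , q) ∷ [] ≋ (q , p) ∷ []
flip-≋ p q = mk≋ λ x y → cong (_+ 0) (trans (+-comm (δ p x * δ q y) _)
  (cong₂ _+_ (*-comm (δ p y) _) (*-comm (δ p x) _)))

-- Gives access to the commutative monoid solver and to setoid reasoning, so that the pieces of a
-- decomposition can be regrouped automatically.
++-commutativeMonoid : CommutativeMonoid _ _
++-commutativeMonoid = record
  { Carrier = List Edge
  ; _≈_     = _≋_
  ; _∙_     = _++_
  ; ε       = []
  ; isCommutativeMonoid = record
    { isMonoid = record
      { isSemigroup = record
        { isMagma = record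
          { isEquivalence = record { refl = ≋-refl ; sym = ≋-sym ; trans = ≋-trans }
          ; ∙-cong = ++-cong
          }
        ; assoc = λ E F G → ≋-reflexive (++-assoc E F G)
        }
      ; identity = (λ _ → ≋-refl) , λ E → ≋-reflexive (++-identityʳ E)
      }
    ; comm = ++-comm
    }
  }

open import Algebra.Solver.CommutativeMonoid ++-commutativeMonoid using (solve; _⊜_; _⊕_)
open import Relation.Binary.Reasoning.Setoid (CommutativeMonoid.setoid ++-commutativeMonoid)

-- Edge lists of paths and complete graphs

pathEdges : Path k → List Edge
pathEdges []          = []
pathEdges (x ∷ [])    = []
pathEdges (x ∷ y ∷ p) = (x , y) ∷ pathEdges (y ∷ p)

edges : List (Path k) → List Edge
edges = concatMap pathEdges

edges-++ : ∀ (Q R : List (Path k)) → edges (Q ++ R) ≡ edges Q ++ edges R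
edges-++ = concatMap-++ pathEdges

complete : List ℕ → List Edge
complete []       = []
complete (x ∷ xs) = map (x ,_) xs ++ complete xs

complete-++ : ∀ xs ys → complete (xs ++ ys) ≋ complete xs ++ cartesianProduct xs ys ++ complete ys
complete-++ []       ys = ≋-refl
complete-++ (x ∷ xs) ys = begin
  map (x ,_) (xs ++ ys) ++ complete (xs ++ ys)
    ≈⟨ ++-cong (≋-reflexive (map-++ (x ,_) xs ys)) (complete-++ xs ys) ⟩
  (map (x ,_) xs ++ map (x ,_) ys) ++ complete xs ++ cartesianProduct xs ys ++ complete ys
    ≈⟨ solve 5 (λ a b c d e → (a ⊕ b) ⊕ (c ⊕ (d ⊕ e)) ⊜ (a ⊕ c) ⊕ ((b ⊕ d) ⊕ e)) ≋-refl
         (map (x ,_) xs) (map (x ,_) ys) (complete xs) (cartesianProduct xs ys) (complete ys) ⟩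
  (map (x ,_) xs ++ complete xs) ++ (map (x ,_) ys ++ cartesianProduct xs ys) ++ complete ys ∎

-- Relabelling

relabel : (ℕ → ℕ) → List Edge → List Edge
relabel φ = map λ (p , q) → φ p , φ q

pathEdges-map : ∀ φ (p : Path k) → pathEdges (Vec.map φ p) ≡ relabel φ (pathEdges p)
pathEdges-map φ []          = refl
pathEdges-map φ (x ∷ [])    = refl
pathEdges-map φ (x ∷ y ∷ p) = cong (_ ∷_) (pathEdges-map φ (y ∷ p))

edges-map : ∀ φ (Q : List (Path k)) → edges (map (Vec.map φ) Q) ≡ relabel φ (edges Q)
edges-map φ []      = refl
edges-map φ (p ∷ Q) = trans (cong₂ _++_ (pathEdges-map φ p) (edges-map φ Q))
                            (sym (map-++ _ (pathEdges p) (edges Q)))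

relabel-star : ∀ φ x ys → relabel φ (map (x ,_) ys) ≡ map (φ x ,_) (map φ ys)
relabel-star φ x ys = trans (sym (map-∘ ys)) (map-∘ ys)

relabel-complete : ∀ φ xs → relabel φ (complete xs) ≡ complete (map φ xs)
relabel-complete φ []       = refl
relabel-complete φ (x ∷ xs) =
  trans (map-++ _ (map (x ,_) xs) (complete xs)) (cong₂ _++_ (relabel-star φ x xs) (relabel-complete φ xs))

relabel-product : ∀ φ xs ys →
  relabel φ (cartesianProduct xs ys) ≡ cartesianProduct (map φ xs) (map φ ys)
relabel-product φ []       ys = refl
relabel-product φ (x ∷ xs) ys =
  trans (map-++ _ (map (x ,_) ys) (cartesianProduct xs ys))
        (cong₂ _++_ (relabel-star φ x ys) (relabel-product φ xs ys))

orient : Edge → Edge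
orient (p , q) = if p ≤ᵇ q then (p , q) else (q , p)

insert : Edge → List Edge → List Edge
insert e []      = e ∷ []
insert e (f ∷ E) =
  if proj₁ e * 16 + proj₂ e ≤ᵇ proj₁ f * 16 + proj₂ f then e ∷ f ∷ E else f ∷ insert e E

-- The sort key presumes labels below 16, but relabel-canon does not depend on it.
canon : List Edge → List Edge
canon []      = []
canon (e ∷ E) = insert (orient e) (canon E)

relabel-orient : ∀ φ e → relabel φ (orient e ∷ []) ≋ relabel φ (e ∷ [])
relabel-orient φ (p , q) with p ≤ᵇ q
... | true  = ≋-refl
... | false = flip-≋ (φ q) (φ p)

relabel-insert : ∀ φ e E → relabel φ (insert e E) ≋ relabel φ (e ∷ E)
relabel-insert φ e []      = ≋-refl
relabel-insert φ e (f ∷ E) with proj₁ e * 16 + proj₂ e ≤ᵇ proj₁ f * 16 + proj₂ f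
... | true  = ≋-refl
... | false = begin
  relabel φ (f ∷ []) ++ relabel φ (insert e E) ≈⟨ ++-cong ≋-refl (relabel-insert φ e E) ⟩
  relabel φ (f ∷ []) ++ relabel φ (e ∷ []) ++ relabel φ E
    ≈⟨ solve 3 (λ a b c → a ⊕ (b ⊕ c) ⊜ b ⊕ (a ⊕ c)) ≋-refl
         (relabel φ (f ∷ [])) (relabel φ (e ∷ [])) (relabel φ E) ⟩
  relabel φ (e ∷ f ∷ E) ∎

relabel-canon : ∀ φ E → relabel φ (canon E) ≋ relabel φ E
relabel-canon φ []      = ≋-refl
relabel-canon φ (e ∷ E) = begin
  relabel φ (insert (orient e) (canon E))           ≈⟨ relabel-insert φ (orient e) (canon E) ⟩
  relabel φ (orient e ∷ []) ++ relabel φ (canon E)  ≈⟨ ++-cong (relabel-orient φ e) (relabel-canon φ E) ⟩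
  relabel φ (e ∷ E)                                 ∎

-- Proof by computation: for concrete lists the hypothesis is `refl`. Reordering and flipping edges
-- survive every relabelling, so one check of a small piece serves all its copies inside arbitrarily
-- large complete graphs.
canon-≋ : ∀ E F → canon E ≡ canon F → ∀ φ → relabel φ E ≋ relabel φ F
canon-≋ E F eq φ = begin
  relabel φ E         ≈⟨ relabel-canon φ E ⟨
  relabel φ (canon E) ≡⟨ cong (relabel φ) eq ⟩
  relabel φ (canon F) ≈⟨ relabel-canon φ F ⟩
  relabel φ F         ∎

canon-id : ∀ E F → canon E ≡ canon F → E ≋ F
canon-id E F eq = subst₂ _≋_ (map-id E) (map-id F) (canon-≋ E F eq id)

-- Extending a decomposition by twelve vertices

range : ℕ → ℕ → List ℕ
range o zero    = []
range o (suc l) = o ∷ range (suc o) l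

range-++ : ∀ o m n → range o (m + n) ≡ range o m ++ range (m + o) n
range-++ o zero    n = refl
range-++ o (suc m) n =
  cong (o ∷_) (trans (range-++ (suc o) m n) (cong (λ h → range (suc o) m ++ range h n) (+-suc m o)))

double : ℕ → ℕ
double zero    = zero
double (suc k) = 2 + double k

-- Inserts a gap of length d below the label s.
raise : ℕ → ℕ → ℕ → ℕ
raise zero    d i       = i + d
raise (suc s) d zero    = zero
raise (suc s) d (suc i) = suc (raise s d i)

raise-injective : ∀ s d {i j} → raise s d i ≡ raise s d j → i ≡ j
raise-injective zero    d               eq = +-cancelʳ-≡ d _ _ eq
raise-injective (suc s) d {zero}  {zero}  eq = refl
raise-injective (suc s) d {suc i} {suc j} eq = cong suc (raise-injective s d (suc-injective eq))

raise-≥ : ∀ s d i → raise s d (i + s) ≡ d + (i + s)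
raise-≥ zero    d i = +-comm (i + 0) d
raise-≥ (suc s) d i rewrite +-suc i s | +-suc d (i + s) = cong suc (raise-≥ s d i)

map-raise-range : ∀ s d i l → map (raise s d) (range (i + s) l) ≡ range (d + (i + s)) l
map-raise-range s d i zero    = refl
map-raise-range s d i (suc l) = cong₂ _∷_ (raise-≥ s d i)
  (trans (map-raise-range s d (suc i) l) (cong (λ h → range h l) (+-suc d (i + s))))

fanLabel : ℕ → ℕ → ℕ → ℕ
fanLabel o k i = raise 2 (double k) i + o

-- The labels 0 and 1 run through the k pairs of vertices from o on, the others follow the last pair.
fan : ℕ → ℕ → List (Path m) → List (Path m)
fan o zero    P = []
fan o (suc k) P = map (Vec.map (fanLabel o k)) P ++ fan (2 + o) k P

map-+-range : ∀ o a l → map (_+ o) (range a l) ≡ range (a + o) l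
map-+-range o a zero    = refl
map-+-range o a (suc l) = cong (a + o ∷_) (map-+-range o (suc a) l)

-- In each recursive call `o` grows by 2 and `k` drops by 1, so the labels from 2 on land on the
-- same twelve vertices in every copy; the k copies of $K_{2,12}$ therefore make up the complete
-- bipartite graph between the 2k old vertices and those twelve.
fan-edges : ∀ o k (P : List (Path m)) → canon (edges P) ≡ canon (cartesianProduct (range 0 2) (range 2 12)) →
            edges (fan o k P) ≋ cartesianProduct (range o (double k)) (range (double k + o) 12)
fan-edges o zero    P eq = ≋-refl
fan-edges o (suc k) P eq = begin
  edges (map (Vec.map φ) P ++ fan (2 + o) k P)
    ≡⟨ edges-++ (map (Vec.map φ) P) _ ⟩
  edges (map (Vec.map φ) P) ++ edges (fan (2 + o) k P)
    ≡⟨ cong (_++ edges (fan (2 + o) k P)) (edges-map φ P) ⟩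
  relabel φ (edges P) ++ edges (fan (2 + o) k P)
    ≈⟨ ++-cong (canon-≋ (edges P) (cartesianProduct (range 0 2) (range 2 12)) eq φ) (fan-edges (2 + o) k P eq) ⟩
  relabel φ (cartesianProduct (range 0 2) (range 2 12)) ++ R (double k + (2 + o))
    ≡⟨ cong₂ _++_ (relabel-product φ (range 0 2) (range 2 12)) (cong R shift) ⟩
  cartesianProduct (range o 2) (map φ (range 2 12)) ++ R N
    ≡⟨ cong (λ ys → cartesianProduct (range o 2) ys ++ R N) new ⟩
  cartesianProduct (range o 2) (range N 12) ++ R N
    ≡⟨ cartesianProductWith-distribʳ-++ _,_ (range o 2) (range (2 + o) (double k)) (range N 12) ⟨
  cartesianProduct (range o (double (suc k))) (range N 12) ∎
  where
    φ = fanLabel o k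
    N = double (suc k) + o
    R : ℕ → List Edge
    R h = cartesianProduct (range (2 + o) (double k)) (range h 12)
    shift : double k + (2 + o) ≡ N
    shift = trans (+-suc (double k) (suc o)) (cong suc (+-suc (double k) o))
    new : map φ (range 2 12) ≡ range N 12
    new = trans (map-∘ {g = _+ o} {f = raise 2 (double k)} (range 2 12))
      (trans (cong (map (_+ o)) (map-raise-range 2 (double k) 0 12))
      (trans (map-+-range o (double k + 2) 12) (cong (λ h → range (h + o) 12) (+-comm (double k) 2))))

-- Generic in the path length, so that the same construction applies to the P₄-design and to the
-- P₃-design linked to it.
extend : ℕ → ℕ → List (Path m) → List (Path m) → List (Path m) → List (Path m)
extend s k G P Q = Q ++ map (Vec.map (raise s (double k))) G ++ fan s k P

edges-fan-++ : ∀ o k (P P′ : List (Path m)) →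
               edges (fan o k P) ++ edges (fan o k P′) ≋ edges (fan o k (P ++ P′))
edges-fan-++ o zero    P P′ = ≋-refl
edges-fan-++ o (suc k) P P′ = begin
  edges (f P ++ r P) ++ edges (f P′ ++ r P′)
    ≡⟨ cong₂ _++_ (edges-++ (f P) _) (edges-++ (f P′) _) ⟩
  (edges (f P) ++ edges (r P)) ++ edges (f P′) ++ edges (r P′)
    ≈⟨ solve 4 (λ a b c d → (a ⊕ b) ⊕ (c ⊕ d) ⊜ (a ⊕ c) ⊕ (b ⊕ d)) ≋-refl
         (edges (f P)) (edges (r P)) (edges (f P′)) (edges (r P′)) ⟩
  (edges (f P) ++ edges (f P′)) ++ edges (r P) ++ edges (r P′)
    ≈⟨ ++-cong (≋-reflexive (trans (sym (edges-++ (f P) _)) (cong edges (sym (map-++ _ P P′)))))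
               (edges-fan-++ (2 + o) k P P′) ⟩
  edges (f (P ++ P′)) ++ edges (r (P ++ P′))
    ≡⟨ edges-++ (f (P ++ P′)) _ ⟨
  edges (fan o (suc k) (P ++ P′)) ∎
  where
    f r : List (Path _) → List (Path _)
    f = map (Vec.map (fanLabel o k))
    r = fan (2 + o) k

edges-extend : ∀ s k (G P Q : List (Path m)) →
  edges (extend s k G P Q) ≡ edges Q ++ relabel (raise s (double k)) (edges G) ++ edges (fan s k P)
edges-extend s k G P Q = trans (edges-++ Q _) (cong (edges Q ++_)
  (trans (edges-++ (map (Vec.map φ) G) _) (cong (_++ edges (fan s k P)) (edges-map φ G))))
  where φ = raise s (double k)

-- In the P₃-design the initial P₃s of the blocks and the additional P₃s are extended separately.
-- Merged into one extension, they can be compared with the complete graph in a single step.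
edges-extend-++ : ∀ s k (G P Q G′ P′ Q′ : List (Path m)) →
  edges (extend s k G P Q ++ extend s k G′ P′ Q′) ≋ edges (extend s k (G ++ G′) (P ++ P′) (Q ++ Q′))
edges-extend-++ s k G P Q G′ P′ Q′ = begin
  edges (extend s k G P Q ++ extend s k G′ P′ Q′)
    ≡⟨ edges-++ (extend s k G P Q) _ ⟩
  edges (extend s k G P Q) ++ edges (extend s k G′ P′ Q′)
    ≡⟨ cong₂ _++_ (edges-extend s k G P Q) (edges-extend s k G′ P′ Q′) ⟩
  (edges Q ++ g G ++ f P) ++ edges Q′ ++ g G′ ++ f P′
    ≈⟨ solve 6 (λ a b c d e h → (a ⊕ (b ⊕ c)) ⊕ (d ⊕ (e ⊕ h)) ⊜ (a ⊕ d) ⊕ ((b ⊕ e) ⊕ (c ⊕ h))) ≋-refl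
         (edges Q) (g G) (f P) (edges Q′) (g G′) (f P′) ⟩
  (edges Q ++ edges Q′) ++ (g G ++ g G′) ++ f P ++ f P′
    ≈⟨ ++-cong (≋-reflexive (sym (edges-++ Q Q′)))
         (++-cong (≋-reflexive (sym (trans (cong (relabel φ) (edges-++ G G′)) (map-++ _ (edges G) _))))
                  (edges-fan-++ s k P P′)) ⟩
  edges (Q ++ Q′) ++ g (G ++ G′) ++ f (P ++ P′)
    ≡⟨ edges-extend s k (G ++ G′) (P ++ P′) (Q ++ Q′) ⟨
  edges (extend s k (G ++ G′) (P ++ P′) (Q ++ Q′)) ∎
  where
    φ = raise s (double k)
    g f : List (Path _) → List Edge
    g G = relabel φ (edges G)
    f P = edges (fan s k P)

-- K on A, U and N splits into K on A and U, the edges at N inside A and N, and the edges from U to N.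
extend-complete : ∀ A s k (G P Q : List (Path m)) → (∀ d → map (raise s d) A ≡ A) →
  canon (edges G) ≡ canon (cartesianProduct A (range s 12) ++ complete (range s 12)) →
  canon (edges P) ≡ canon (cartesianProduct (range 0 2) (range 2 12)) →
  edges Q ≋ complete (A ++ range s (double k)) →
  edges (extend s k G P Q) ≋ complete (A ++ range s (double (6 + k)))
extend-complete A s k G P Q fixed g p q = begin
  edges (extend s k G P Q)
    ≡⟨ edges-extend s k G P Q ⟩
  edges Q ++ relabel φ (edges G) ++ edges (fan s k P)
    ≈⟨ ++-cong q (++-cong (canon-≋ (edges G) _ g φ) (fan-edges s k P p)) ⟩
  complete (A ++ U) ++ relabel φ (cartesianProduct A N₀ ++ complete N₀) ++ cartesianProduct U N
    ≡⟨ cong (λ E → complete (A ++ U) ++ E ++ cartesianProduct U N) moved ⟩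
  complete (A ++ U) ++ (cartesianProduct A N ++ complete N) ++ cartesianProduct U N
    ≈⟨ solve 4 (λ a b c d → a ⊕ ((b ⊕ c) ⊕ d) ⊜ a ⊕ ((b ⊕ d) ⊕ c)) ≋-refl
         (complete (A ++ U)) (cartesianProduct A N) (complete N) (cartesianProduct U N) ⟩
  complete (A ++ U) ++ (cartesianProduct A N ++ cartesianProduct U N) ++ complete N
    ≡⟨ cong (λ E → complete (A ++ U) ++ E ++ complete N) (cartesianProductWith-distribʳ-++ _,_ A U N) ⟨
  complete (A ++ U) ++ cartesianProduct (A ++ U) N ++ complete N
    ≈⟨ complete-++ (A ++ U) N ⟨
  complete ((A ++ U) ++ N)
    ≡⟨ cong complete (trans (++-assoc A U N) (cong (A ++_) joined)) ⟩
  complete (A ++ range s (double (6 + k))) ∎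
  where
    φ = raise s (double k)
    U = range s (double k)
    N = range (double k + s) 12
    N₀ = range s 12
    N₀↦N : map φ N₀ ≡ N
    N₀↦N = map-raise-range s (double k) 0 12
    moved : relabel φ (cartesianProduct A N₀ ++ complete N₀) ≡ cartesianProduct A N ++ complete N
    moved = trans (map-++ _ (cartesianProduct A N₀) _) (cong₂ _++_
      (trans (relabel-product φ A N₀) (cong₂ cartesianProduct (fixed (double k)) N₀↦N))
      (trans (relabel-complete φ N₀) (cong complete N₀↦N)))
    joined : U ++ N ≡ range s (double (6 + k))
    joined = trans (sym (range-++ s (double k) 12)) (cong (range s) (+-comm (double k) 12))

All-fan⁺ : ∀ o k {P : List (Path m)} → All Unique P → All Unique (fan o k P)
All-fan⁺ o zero    us = []
All-fan⁺ o (suc k) us = AllP.++⁺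
  (AllP.map⁺ (All.map (UniqueP.map⁺ λ {i} {j} eq → raise-injective 2 (double k) (+-cancelʳ-≡ o _ _ eq)) us))
  (All-fan⁺ (2 + o) k us)

All-extend⁺ : ∀ s k {G P Q : List (Path m)} → All Unique G → All Unique P → All Unique Q →
              All Unique (extend s k G P Q)
All-extend⁺ s k g p q = AllP.++⁺ q (AllP.++⁺
  (AllP.map⁺ (All.map (UniqueP.map⁺ (raise-injective s (double k))) g)) (All-fan⁺ s k p))

-- Linked decompositions into P₄s and P₃s, and their recursive step

front : Path 4 → Path 3
front (a ∷ b ∷ c ∷ d ∷ []) = path₃ a b c

front-map : ∀ φ p → front (Vec.map φ p) ≡ Vec.map φ (front p)
front-map φ (a ∷ b ∷ c ∷ d ∷ []) = refl

map-front-map : ∀ φ Q → map front (map (Vec.map φ) Q) ≡ map (Vec.map φ) (map front Q)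
map-front-map φ Q = trans (sym (map-∘ Q)) (trans (map-cong (front-map φ) Q) (map-∘ Q))

map-front-fan : ∀ o k P → map front (fan o k P) ≡ fan o k (map front P)
map-front-fan o zero    P = refl
map-front-fan o (suc k) P = trans (map-++ front (map (Vec.map (fanLabel o k)) P) _)
  (cong₂ _++_ (map-front-map (fanLabel o k) P) (map-front-fan (2 + o) k P))

-- Relabelling leaves positions in a path unchanged, so dropping last edges commutes with the
-- construction and the recursion acts on the P₃s as well.
map-front-extend : ∀ s k G P Q →
  map front (extend s k G P Q) ≡ extend s k (map front G) (map front P) (map front Q)
map-front-extend s k G P Q = trans (map-++ front Q _) (cong (map front Q ++_)
  (trans (map-++ front (map (Vec.map φ) G) _) (cong₂ _++_ (map-front-map φ G) (map-front-fan s k P))))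
  where φ = raise s (double k)

-- These are the vertices that no P₃ inside the respective block can avoid.
middles : List (Path 4) → List ℕ
middles = concatMap λ { (a ∷ b ∷ c ∷ d ∷ []) → b ∷ c ∷ [] }

middles-map : ∀ φ Q → middles (map (Vec.map φ) Q) ≡ map φ (middles Q)
middles-map φ []                            = refl
middles-map φ ((a ∷ b ∷ c ∷ d ∷ []) ∷ Q) = cong (λ l → φ b ∷ φ c ∷ l) (middles-map φ Q)

unique? : (p : Path k) → Dec (Unique p)
unique? = allPairs? λ x y → ¬? (x ≟ y)

simple? : (Q : List (Path k)) → Dec (All Unique Q)
simple? = All.all? unique?

-- Only s ≤ 2 occurs, with A equal to {0, …, s − 1} (links to order v) or to {1, …, s − 1} (order v − 1).
record Linked (A : List ℕ) (s k : ℕ) : Set where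
  field
    Q      : List (Path 4)
    T      : List (Path 3)
    simple : All Unique Q
    full   : edges Q ≋ complete (range 0 s ++ range s (double k))
    link   : edges (map front Q ++ T) ≋ complete (A ++ range s (double k))

-- The part of the recursive step that is independent of `k`. `full` and `link` concern fixed lists
-- and are checked by evaluation; `fixed₀` and `fixed` say that opening a gap at `s` moves none of
-- the distinguished vertices.
record LinkedStep (A : List ℕ) (s : ℕ) : Set where
  field
    G      : List (Path 4)
    T      : List (Path 3)
    simple : All Unique G
    fixed₀ : ∀ d → map (raise s d) (range 0 s) ≡ range 0 s
    fixed  : ∀ d → map (raise s d) A ≡ A
    full   : canon (edges G) ≡ canon (cartesianProduct (range 0 s) (range s 12) ++ complete (range s 12))
    link   : canon (edges (map front G ++ T)) ≡
             canon (cartesianProduct A (range s 12) ++ complete (range s 12))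

-- The decompositions below come from a computer search.  The last edge of each P₄ is the one dropped;
-- in the pointed ones it is the edge at 0 whenever the path contains 0.  pair decomposes K_{2,12}, and
-- pointed14 decomposes K₁₄ without the edge 01; each other name gives the order of the complete graph.
pair-Q : List (Path 4)
pair-Q =
    path₄ 0 9 1 11 ∷ path₄ 1 3 0 6 ∷ path₄ 1 4 0 12 ∷ path₄ 1 5 0 11 ∷ path₄ 1 8 0 10 ∷
    path₄ 6 1 2 0 ∷ path₄ 10 1 7 0 ∷ path₄ 12 1 13 0 ∷ []

pair-T : List (Path 3)
pair-T =
    path₃ 0 11 1 ∷ path₃ 2 0 6 ∷ path₃ 10 0 7 ∷ path₃ 13 0 12 ∷ []

plain4-Q : List (Path 4)
plain4-Q =
    path₄ 1 2 0 3 ∷ path₄ 2 3 1 0 ∷ []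

plain4-T : List (Path 3)
plain4-T =
    path₃ 1 0 3 ∷ []

plain9-Q : List (Path 4)
plain9-Q =
    path₄ 1 4 0 7 ∷ path₄ 1 6 8 3 ∷ path₄ 2 7 6 4 ∷ path₄ 3 4 5 1 ∷ path₄ 4 2 1 0 ∷
    path₄ 5 0 6 2 ∷ path₄ 6 5 3 1 ∷ path₄ 7 5 8 4 ∷ path₄ 8 0 2 5 ∷ path₄ 8 1 7 4 ∷
    path₄ 8 2 3 6 ∷ path₄ 8 7 3 0 ∷ []

plain9-T : List (Path 3)
plain9-T =
    path₃ 1 3 8 ∷ path₃ 1 5 2 ∷ path₃ 2 6 4 ∷ path₃ 6 3 0 ∷ path₃ 7 0 1 ∷ path₃ 8 4 7 ∷ []

plain12-Q : List (Path 4)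
plain12-Q =
    path₄ 0 10 11 7 ∷ path₄ 1 6 7 10 ∷ path₄ 1 11 0 6 ∷ path₄ 2 7 4 1 ∷ path₄ 2 8 1 5 ∷
    path₄ 3 0 4 2 ∷ path₄ 3 6 5 10 ∷ path₄ 3 9 2 1 ∷ path₄ 4 8 3 11 ∷ path₄ 4 10 8 11 ∷
    path₄ 5 4 9 8 ∷ path₄ 5 8 0 1 ∷ path₄ 6 2 10 1 ∷ path₄ 6 11 5 9 ∷ path₄ 7 1 9 11 ∷
    path₄ 7 3 2 0 ∷ path₄ 7 5 3 1 ∷ path₄ 7 8 6 4 ∷ path₄ 10 6 9 7 ∷ path₄ 10 9 0 7 ∷
    path₄ 11 2 5 0 ∷ path₄ 11 4 3 10 ∷ []

plain12-T : List (Path 3)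
plain12-T =
    path₃ 0 7 9 ∷ path₃ 1 10 7 ∷ path₃ 2 0 1 ∷ path₃ 3 1 2 ∷ path₃ 4 1 5 ∷ path₃ 5 0 6 ∷
    path₃ 6 4 2 ∷ path₃ 7 11 9 ∷ path₃ 9 5 10 ∷ path₃ 11 3 10 ∷ path₃ 11 8 9 ∷ []

plain13-Q : List (Path 4)
plain13-Q =
    path₄ 0 2 12 10 ∷ path₄ 0 5 10 11 ∷ path₄ 2 11 6 12 ∷ path₄ 3 0 4 11 ∷ path₄ 3 11 12 0 ∷
    path₄ 3 12 1 9 ∷ path₄ 4 5 12 7 ∷ path₄ 4 7 3 9 ∷ path₄ 5 2 6 3 ∷ path₄ 6 0 11 8 ∷
    path₄ 6 1 0 7 ∷ path₄ 6 4 1 7 ∷ path₄ 6 5 1 2 ∷ path₄ 6 7 11 1 ∷ path₄ 7 2 3 10 ∷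
    path₄ 7 5 8 10 ∷ path₄ 7 8 3 5 ∷ path₄ 8 0 10 1 ∷ path₄ 8 2 9 6 ∷ path₄ 8 4 3 1 ∷
    path₄ 8 9 4 2 ∷ path₄ 8 12 9 11 ∷ path₄ 9 7 10 2 ∷ path₄ 9 10 4 12 ∷ path₄ 10 6 8 1 ∷
    path₄ 11 5 9 0 ∷ []

plain13-T : List (Path 3)
plain13-T =
    path₃ 1 7 0 ∷ path₃ 1 8 11 ∷ path₃ 1 10 8 ∷ path₃ 2 1 11 ∷ path₃ 4 2 10 ∷ path₃ 5 3 9 ∷
    path₃ 6 12 4 ∷ path₃ 7 12 0 ∷ path₃ 9 1 3 ∷ path₃ 9 6 3 ∷ path₃ 10 11 4 ∷ path₃ 11 9 0 ∷
    path₃ 12 10 3 ∷ []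

pointed6-Q : List (Path 4)
pointed6-Q =
    path₄ 1 2 5 0 ∷ path₄ 2 3 4 0 ∷ path₄ 3 5 1 0 ∷ path₄ 4 1 3 0 ∷ path₄ 5 4 2 0 ∷ []

pointed6-T : List (Path 3)
pointed6-T = []

pointed9-Q : List (Path 4)
pointed9-Q =
    path₄ 1 4 5 0 ∷ path₄ 2 3 8 0 ∷ path₄ 2 5 7 0 ∷ path₄ 5 1 8 7 ∷ path₄ 5 6 1 0 ∷
    path₄ 6 2 4 0 ∷ path₄ 6 7 2 0 ∷ path₄ 7 4 3 0 ∷ path₄ 8 2 1 7 ∷ path₄ 8 4 6 0 ∷
    path₄ 8 5 3 7 ∷ path₄ 8 6 3 1 ∷ []

pointed9-T : List (Path 3)
pointed9-T =
    path₃ 3 7 8 ∷ path₃ 7 1 3 ∷ []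

pointed10-Q : List (Path 4)
pointed10-Q =
    path₄ 1 2 9 0 ∷ path₄ 2 6 7 0 ∷ path₄ 3 1 9 4 ∷ path₄ 3 2 4 0 ∷ path₄ 3 9 8 7 ∷
    path₄ 5 4 3 0 ∷ path₄ 6 3 5 0 ∷ path₄ 7 2 8 4 ∷ path₄ 7 3 8 0 ∷ path₄ 7 4 6 9 ∷
    path₄ 7 5 2 0 ∷ path₄ 8 1 6 0 ∷ path₄ 8 5 1 0 ∷ path₄ 8 6 5 9 ∷ path₄ 9 7 1 4 ∷ []

pointed10-T : List (Path 3)
pointed10-T =
    path₃ 5 9 6 ∷ path₃ 7 8 4 ∷ path₃ 9 4 1 ∷ []

pointed13-Q : List (Path 4)
pointed13-Q =
    path₄ 1 9 11 0 ∷ path₄ 1 10 8 0 ∷ path₄ 1 12 10 11 ∷ path₄ 3 1 6 4 ∷ path₄ 3 6 11 4 ∷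
    path₄ 3 10 4 0 ∷ path₄ 3 11 2 8 ∷ path₄ 4 2 1 5 ∷ path₄ 4 5 10 0 ∷ path₄ 5 2 12 3 ∷
    path₄ 5 8 4 1 ∷ path₄ 5 12 9 7 ∷ path₄ 6 10 7 11 ∷ path₄ 7 2 3 0 ∷ path₄ 8 1 7 0 ∷
    path₄ 8 7 4 3 ∷ path₄ 8 9 5 3 ∷ path₄ 9 3 8 6 ∷ path₄ 9 6 2 0 ∷ path₄ 10 2 9 0 ∷
    path₄ 10 9 4 12 ∷ path₄ 11 5 6 0 ∷ path₄ 11 8 12 0 ∷ path₄ 12 6 7 3 ∷ path₄ 12 7 5 0 ∷
    path₄ 12 11 1 0 ∷ []

pointed13-T : List (Path 3)
pointed13-T =
    path₃ 2 8 6 ∷ path₃ 3 4 6 ∷ path₃ 5 1 4 ∷ path₃ 7 11 10 ∷ path₃ 9 7 3 ∷ path₃ 12 3 5 ∷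
    path₃ 12 4 11 ∷ []

pointed14-Q : List (Path 4)
pointed14-Q =
    path₄ 1 2 5 3 ∷ path₄ 1 7 4 9 ∷ path₄ 1 11 7 9 ∷ path₄ 2 12 10 0 ∷ path₄ 3 1 13 0 ∷
    path₄ 3 4 2 6 ∷ path₄ 3 6 5 0 ∷ path₄ 4 1 12 0 ∷ path₄ 5 4 11 13 ∷ path₄ 5 12 4 0 ∷
    path₄ 6 4 13 12 ∷ path₄ 6 7 12 11 ∷ path₄ 6 10 13 5 ∷ path₄ 7 5 9 0 ∷ path₄ 7 10 5 8 ∷
    path₄ 7 13 6 9 ∷ path₄ 8 4 10 1 ∷ path₄ 8 6 11 0 ∷ path₄ 9 1 8 13 ∷ path₄ 9 12 6 0 ∷
    path₄ 9 13 3 7 ∷ path₄ 10 3 2 9 ∷ path₄ 10 8 11 3 ∷ path₄ 10 9 8 0 ∷ path₄ 11 2 7 0 ∷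
    path₄ 11 5 1 6 ∷ path₄ 11 10 2 0 ∷ path₄ 12 3 9 11 ∷ path₄ 12 8 3 0 ∷ path₄ 13 2 8 7 ∷ []

pointed14-T : List (Path 3)
pointed14-T =
    path₃ 2 6 9 ∷ path₃ 3 7 9 ∷ path₃ 4 9 2 ∷ path₃ 5 3 11 ∷ path₃ 6 1 10 ∷ path₃ 7 8 5 ∷
    path₃ 8 13 11 ∷ path₃ 9 11 12 ∷ path₃ 12 13 5 ∷ []

interior6-Q : List (Path 4)
interior6-Q =
    path₄ 0 2 1 4 ∷ path₄ 0 3 2 4 ∷ path₄ 0 4 5 2 ∷ path₄ 1 0 5 3 ∷ path₄ 4 3 1 5 ∷ []

interior10-Q : List (Path 4)
interior10-Q =
    path₄ 0 2 5 7 ∷ path₄ 1 0 7 9 ∷ path₄ 1 2 9 8 ∷ path₄ 1 4 5 3 ∷ path₄ 1 6 2 3 ∷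
    path₄ 1 9 4 6 ∷ path₄ 2 8 7 6 ∷ path₄ 3 0 8 4 ∷ path₄ 3 4 2 7 ∷ path₄ 3 6 0 4 ∷
    path₄ 4 7 3 9 ∷ path₄ 5 0 9 6 ∷ path₄ 5 1 3 8 ∷ path₄ 5 8 1 7 ∷ path₄ 8 6 5 9 ∷ []

pair-simple : All Unique pair-Q
pair-simple = from-yes (simple? pair-Q)

-- `extend-complete` settles both sides: with {0, ..., s - 1} as the fixed part for the P₄s, and
-- with `A` for the P₃s.
extendLinked : ∀ {A s k} → LinkedStep A s → Linked A s k → Linked A s (6 + k)
extendLinked {A} {s} {k} S L = record
  { Q      = extend s k S.G pair-Q L.Q
  ; T      = extend s k S.T pair-T L.T
  ; simple = All-extend⁺ s k S.simple pair-simple L.simple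
  ; full   = extend-complete (range 0 s) s k S.G pair-Q L.Q S.fixed₀ S.full refl L.full
  ; link   = ≋-trans
      (≋-trans (≋-reflexive (cong (λ Q → edges (Q ++ extend s k S.T pair-T L.T))
                  (map-front-extend s k S.G pair-Q L.Q)))
               (edges-extend-++ s k (map front S.G) (map front pair-Q) (map front L.Q) S.T pair-T L.T))
      (extend-complete A s k (map front S.G ++ S.T) (map front pair-Q ++ pair-T) (map front L.Q ++ L.T)
        S.fixed S.link refl L.link)
  }
  where
    module S = LinkedStep S
    module L = Linked L

linked : ∀ {A s k} Q T → {True (simple? Q)} →
         canon (edges Q) ≡ canon (complete (range 0 s ++ range s (double k))) →
         canon (edges (map front Q ++ T)) ≡ canon (complete (A ++ range s (double k))) →
         Linked A s k
linked Q T {u} f l = record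
  { Q = Q ; T = T ; simple = toWitness u
  ; full = canon-id (edges Q) _ f ; link = canon-id (edges (map front Q ++ T)) _ l }

plainEven : LinkedStep [] 0
plainEven = record
  { G = plain12-Q ; T = plain12-T ; simple = from-yes (simple? plain12-Q)
  ; fixed₀ = λ _ → refl ; fixed = λ _ → refl ; full = refl ; link = refl }

plainOdd : LinkedStep (0 ∷ []) 1
plainOdd = record
  { G = plain13-Q ; T = plain13-T ; simple = from-yes (simple? plain13-Q)
  ; fixed₀ = λ _ → refl ; fixed = λ _ → refl ; full = refl ; link = refl }

-- Without the vertex 0, an even order leaves an odd number of old vertices; the vertex 1 is set
-- aside as well so that the others can be paired.
pointedEven : LinkedStep (1 ∷ []) 2
pointedEven = record
  { G = pointed14-Q ; T = pointed14-T ; simple = from-yes (simple? pointed14-Q)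
  ; fixed₀ = λ _ → refl ; fixed = λ _ → refl ; full = refl ; link = refl }

pointedOdd : LinkedStep [] 1
pointedOdd = record
  { G = pointed13-Q ; T = pointed13-T ; simple = from-yes (simple? pointed13-Q)
  ; fixed₀ = λ _ → refl ; fixed = λ _ → refl ; full = refl ; link = refl }

-- Adjacency and multiplicity

Joins : List Edge → ℕ → ℕ → Set
Joins E x y = (x , y) ∈ E ⊎ (y , x) ∈ E

joins? : ∀ E x y → Dec (Joins E x y)
joins? E x y = ((x , y) ∈E? E) ⊎-dec ((y , x) ∈E? E)
  where _∈E?_ = _∈?_ (≡-dec _≟_ _≟_)

δ-refl : ∀ x → δ x x ≡ 1
δ-refl x = cong (if_then 1 else 0) (dec-true (x ≟ x) refl)

δ-≢ : x ≢ y → δ x y ≡ 0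
δ-≢ {x} {y} x≢y = cong (if_then 1 else 0) (dec-false (x ≟ y) x≢y)

hit-comm : ∀ e x y → hit e x y ≡ hit e y x
hit-comm (p , q) x y = +-comm (δ p x * δ q y) _

mult-comm : ∀ E x y → mult E x y ≡ mult E y x
mult-comm []      x y = refl
mult-comm (e ∷ E) x y = cong₂ _+_ (hit-comm e x y) (mult-comm E x y)

hit-self : ∀ x y → hit (x , y) x y ≢ 0
hit-self x y eq with () ←
  trans (sym (cong₂ (λ a b → a * b) (δ-refl x) (δ-refl y))) (m+n≡0⇒m≡0 (δ x x * δ y y) eq)

hit-≢ˡ : ∀ p q {x y} → p ≢ x → p ≢ y → hit (p , q) x y ≡ 0
hit-≢ˡ p q {x} {y} p≢x p≢y rewrite δ-≢ p≢x | δ-≢ p≢y = refl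

hit-¬joins : ∀ p q {x y} → (x , y) ≢ (p , q) → (y , x) ≢ (p , q) → hit (p , q) x y ≡ 0
hit-¬joins p q {x} {y} a b = cong₂ _+_ (one a) (one b)
  where
    one : ∀ {x y} → (x , y) ≢ (p , q) → δ p x * δ q y ≡ 0
    one {x} {y} ne with p ≟ x
    ... | no  p≢x  = cong (_* δ q y) (δ-≢ p≢x)
    ... | yes refl = trans (cong (δ p p *_) (δ-≢ {q} {y} λ { refl → ne refl })) (*-zeroʳ (δ p p))

∈⇒mult≢0 : (x , y) ∈ E → mult E x y ≢ 0
∈⇒mult≢0 {x} {y} (here refl) eq = hit-self x y (m+n≡0⇒m≡0 (hit (x , y) x y) eq)
∈⇒mult≢0 {x} {y} {e ∷ _} (there e∈) eq = ∈⇒mult≢0 e∈ (m+n≡0⇒n≡0 (hit e x y) eq)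

joins⇒mult≢0 : Joins E x y → mult E x y ≢ 0
joins⇒mult≢0         (inj₁ e∈)    = ∈⇒mult≢0 e∈
joins⇒mult≢0 {E} {x} {y} (inj₂ e∈) eq = ∈⇒mult≢0 e∈ (trans (mult-comm E y x) eq)

¬joins⇒mult≡0 : ∀ E → ¬ Joins E x y → mult E x y ≡ 0
¬joins⇒mult≡0 []            ¬j = refl
¬joins⇒mult≡0 ((p , q) ∷ E) ¬j = cong₂ _+_
  (hit-¬joins p q (¬j ∘ inj₁ ∘ here) (¬j ∘ inj₂ ∘ here))
  (¬joins⇒mult≡0 E (¬j ∘ Sum.map there there))

mult≢0⇒joins : mult E x y ≢ 0 → Joins E x y
mult≢0⇒joins {E} {x} {y} ne with joins? E x y
... | yes j  = j
... | no  ¬j = ⊥-elim (ne (¬joins⇒mult≡0 E ¬j))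

-- Complete graphs

complete⁺ : ∀ {X} → x ∈ X → y ∈ X → x ≢ y → Joins (complete X) x y
complete⁺ (here refl) (here refl) x≢y = ⊥-elim (x≢y refl)
complete⁺ (here refl) (there y∈)  x≢y = inj₁ (∈-++⁺ˡ (∈-map⁺ _ y∈))
complete⁺ (there x∈)  (here refl) x≢y = inj₂ (∈-++⁺ˡ (∈-map⁺ _ x∈))
complete⁺ {X = z ∷ X} (there x∈)  (there y∈)  x≢y =
  Sum.map (∈-++⁺ʳ (map (z ,_) X)) (∈-++⁺ʳ (map (z ,_) X)) (complete⁺ x∈ y∈ x≢y)

∈complete⁻ : ∀ X → (x , y) ∈ complete X → x ∈ X × y ∈ X
∈complete⁻ (z ∷ X) e∈ with ∈-++⁻ (map (z ,_) X) e∈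
... | inj₁ e∈ˡ with _ , y∈ , refl ← ∈-map⁻ (z ,_) e∈ˡ = here refl , there y∈
... | inj₂ e∈ʳ = Product.map there there (∈complete⁻ X e∈ʳ)

complete⁻ : ∀ X → Joins (complete X) x y → x ∈ X × y ∈ X
complete⁻ X (inj₁ e∈) = ∈complete⁻ X e∈
complete⁻ X (inj₂ e∈) = Product.swap (∈complete⁻ X e∈)

mult-star : ∀ z X {x y} → z ≢ x → z ≢ y → mult (map (z ,_) X) x y ≡ 0
mult-star z []      z≢x z≢y = refl
mult-star z (v ∷ X) z≢x z≢y = cong₂ _+_ (hit-≢ˡ z v z≢x z≢y) (mult-star z X z≢x z≢y)

mult-star-∉ : ∀ z X {y} → z ≢ y → y ∉ X → mult (map (z ,_) X) z y ≡ 0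
mult-star-∉ z X z≢y y∉ = ¬joins⇒mult≡0 (map (z ,_) X)
  λ { (inj₁ e∈) → let _ , v∈ , eq = ∈-map⁻ (z ,_) e∈ in y∉ (subst (_∈ X) (sym (cong proj₂ eq)) v∈)
    ; (inj₂ e∈) → let _ , _ , eq = ∈-map⁻ (z ,_) e∈ in z≢y (sym (cong proj₁ eq)) }

hit-≡ : x ≢ y → hit (x , y) x y ≡ 1
hit-≡ {x} {y} x≢y = cong₂ _+_ (cong₂ _*_ (δ-refl x) (δ-refl y)) (cong₂ _*_ (δ-≢ x≢y) (δ-≢ (≢-sym x≢y)))

mult-star-∈ : ∀ {z X y} → z ≢ y → ListUnique.Unique X → y ∈ X → mult (map (z ,_) X) z y ≡ 1
mult-star-∈ {z} {v ∷ X} z≢y (v∉ ∷ u) (here refl) =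
  cong₂ _+_ (hit-≡ z≢y) (mult-star-∉ z X z≢y λ v∈ → All.lookup v∉ v∈ refl)
mult-star-∈ {z} {v ∷ X} z≢y (v∉ ∷ u) (there y∈) = cong₂ _+_
  (hit-¬joins z v (λ { refl → All.lookup v∉ y∈ refl }) (λ { refl → z≢y refl })) (mult-star-∈ z≢y u y∈)

mult-complete : ∀ {X x y} → ListUnique.Unique X → x ∈ X → y ∈ X → x ≢ y → mult (complete X) x y ≡ 1
mult-complete {z ∷ X} {x} {y} u x∈ y∈ x≢y = trans (mult-++ (map (z ,_) X) (complete X) x y) (go u x∈ y∈)
  where
    outside : ∀ {x} → x ∉ X → mult (complete X) x y ≡ 0 × mult (complete X) y x ≡ 0
    outside x∉ = ¬joins⇒mult≡0 (complete X) (x∉ ∘ proj₁ ∘ complete⁻ X)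
               , ¬joins⇒mult≡0 (complete X) (x∉ ∘ proj₂ ∘ complete⁻ X)
    go : ListUnique.Unique (z ∷ X) → x ∈ z ∷ X → y ∈ z ∷ X →
         mult (map (z ,_) X) x y + mult (complete X) x y ≡ 1
    go (z∉ ∷ u) (here refl) (here refl) = ⊥-elim (x≢y refl)
    go (z∉ ∷ u) (here refl) (there y∈)  =
      cong₂ _+_ (mult-star-∈ x≢y u y∈) (proj₁ (outside λ z∈ → All.lookup z∉ z∈ refl))
    go (z∉ ∷ u) (there x∈)  (here refl) = cong₂ _+_
      (trans (mult-comm (map (z ,_) X) x y) (mult-star-∈ (≢-sym x≢y) u x∈))
      (¬joins⇒mult≡0 (complete X) λ j → All.lookup z∉ (proj₂ (complete⁻ X j)) refl)
    go (z∉ ∷ u) (there x∈)  (there y∈)  =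
      cong₂ _+_ (mult-star z X (All.lookup z∉ x∈) (All.lookup z∉ y∈)) (mult-complete u x∈ y∈ x≢y)

-- Paths as graphs

Consecutive : Fin k → Fin k → Set
Consecutive i j = suc (toℕ i) ≡ toℕ j ⊎ suc (toℕ j) ≡ toℕ i

pathEdges⁺ : ∀ (p : Path k) i j → suc (toℕ i) ≡ toℕ j → (lookup p i , lookup p j) ∈ pathEdges p
pathEdges⁺ (x ∷ y ∷ p) zero    (suc zero) eq = here refl
pathEdges⁺ (x ∷ y ∷ p) (suc i) (suc j)    eq = there (pathEdges⁺ (y ∷ p) i j (suc-injective eq))

pathEdges⁻ : ∀ (p : Path k) → (x , y) ∈ pathEdges p →
             ∃₂ λ i j → suc (toℕ i) ≡ toℕ j × x ≡ lookup p i × y ≡ lookup p j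
pathEdges⁻ (x ∷ y ∷ p) (here refl) = zero , suc zero , refl , refl , refl
pathEdges⁻ (x ∷ y ∷ p) (there e∈) with i , j , eq , x≡ , y≡ ← pathEdges⁻ (y ∷ p) e∈ =
  suc i , suc j , cong suc eq , x≡ , y≡

joins-path⁺ : ∀ (p : Path k) {i j} → Consecutive i j → Joins (pathEdges p) (lookup p i) (lookup p j)
joins-path⁺ p {i} {j} = Sum.map (pathEdges⁺ p i j) (pathEdges⁺ p j i)

joins-path⁻ : ∀ (p : Path k) → Joins (pathEdges p) x y →
              ∃₂ λ i j → Consecutive i j × x ≡ lookup p i × y ≡ lookup p j
joins-path⁻ p (inj₁ e∈) with i , j , eq , x≡ , y≡ ← pathEdges⁻ p e∈ = i , j , inj₁ eq , x≡ , y≡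
joins-path⁻ p (inj₂ e∈) with i , j , eq , y≡ , x≡ ← pathEdges⁻ p e∈ = j , i , inj₂ eq , x≡ , y≡

mult-path : ∀ {p : Path k} → Unique p → Joins (pathEdges p) x y → mult (pathEdges p) x y ≡ 1
mult-path {p = []}        _ (inj₁ ())
mult-path {p = []}        _ (inj₂ ())
mult-path {p = _ ∷ []}    _ (inj₁ ())
mult-path {p = _ ∷ []}    _ (inj₂ ())
mult-path {p = a ∷ b ∷ p} ((a≢b ∷ a∉) ∷ u) j = go j
  where
    -- The first vertex does not recur, so the premise is contradictory; the equation is only a form
    -- of absurdity that `a≢b` can refute.
    away : ∀ {x} → Joins (pathEdges (b ∷ p)) a x → a ≡ x
    away j with i , _ , _ , a≡ , _ ← joins-path⁻ (b ∷ p) j = ⊥-elim (VecAllP.lookup⁺ (a≢b ∷ a∉) i a≡)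
    first : mult (pathEdges (a ∷ b ∷ p)) a b ≡ 1
    first = cong₂ _+_ (hit-≡ a≢b) (¬joins⇒mult≡0 (pathEdges (b ∷ p)) (a≢b ∘ away))
    later : ∀ {x y} → Joins (pathEdges (b ∷ p)) x y → mult (pathEdges (a ∷ b ∷ p)) x y ≡ 1
    later j with i , l , _ , refl , refl ← joins-path⁻ (b ∷ p) j = cong₂ _+_
      (hit-≢ˡ a b (VecAllP.lookup⁺ (a≢b ∷ a∉) i) (VecAllP.lookup⁺ (a≢b ∷ a∉) l)) (mult-path u j)
    go : ∀ {x y} → Joins (pathEdges (a ∷ b ∷ p)) x y → mult (pathEdges (a ∷ b ∷ p)) x y ≡ 1
    go (inj₁ (here refl)) = first
    go (inj₁ (there e∈))  = later (inj₁ e∈)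
    go (inj₂ (here refl)) = trans (mult-comm (pathEdges (a ∷ b ∷ p)) b a) first
    go (inj₂ (there e∈))  = later (inj₂ e∈)

pathGraph : (p : Path k) → Unique p → Graph
pathGraph p u = record
  { vertexSet = record
    { elements = tabulate (lookup p)
    ; unique   = ListUniqueP.tabulate⁺ λ {i} {j} → UniqueP.lookup-injective u i j
    }
  ; _~_       = Joins (pathEdges p)
  ; ~-dec     = joins? (pathEdges p)
  ; ~-sym     = swap
  ; ~-irrefl  = irrefl
  ; incident  = incident
  }
  where
    irrefl : ∀ {x y} → x ≡ y → ¬ Joins (pathEdges p) x y
    irrefl refl j with i , l , c , refl , eq ← joins-path⁻ p j with refl ← UniqueP.lookup-injective u i l eq =
      Sum.[ 1+n≢n , 1+n≢n ] c
    incident : ∀ {x y} → Joins (pathEdges p) x y → x ∈ tabulate (lookup p)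
    incident j with i , _ , _ , refl , _ ← joins-path⁻ p j = ∈-tabulate⁺ i

vertex-≡ : ∀ (G : Graph) {u w : Graph.Vertex G} → proj₁ u ≡ proj₁ w → u ≡ w
vertex-≡ G {_ , x∈} {_ , y∈} refl = cong (_ ,_) (unique⇒irrelevant (Graph.unique G) x∈ y∈)

pathGraph-≅ : (p : Path k) (u : Unique p) → pathGraph p u ≅ᴳ P k
pathGraph-≅ {k} p u = mk↔ₛ′ to from to∘from from∘to , λ a b → mk⇔ (to-~ a b) (from-~ a b)
  where
    G = pathGraph p u
    position : Graph.Vertex G → Fin k
    position (_ , x∈) = proj₁ (∈-tabulate⁻ x∈)
    position-lookup : ∀ a → proj₁ a ≡ lookup p (position a)
    position-lookup (_ , x∈) = proj₂ (∈-tabulate⁻ x∈)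
    to : Graph.Vertex G → Graph.Vertex (P k)
    to a = toℕ (position a) , ∈-upTo⁺ (toℕ<n (position a))
    from : Graph.Vertex (P k) → Graph.Vertex G
    from (m , m∈) = lookup p (fromℕ< (∈-upTo⁻ m∈)) , ∈-tabulate⁺ _
    to∘from : ∀ b → to (from b) ≡ b
    to∘from b@(m , m∈) = vertex-≡ (P k) (trans
      (cong toℕ (UniqueP.lookup-injective u _ _ (sym (position-lookup (from b))))) (toℕ-fromℕ< (∈-upTo⁻ m∈)))
    from∘to : ∀ a → from (to a) ≡ a
    from∘to a = vertex-≡ G (trans
      (cong (lookup p) (toℕ-injective (toℕ-fromℕ< (∈-upTo⁻ (proj₂ (to a)))))) (sym (position-lookup a)))
    to-~ : ∀ a b → Joins (pathEdges p) (proj₁ a) (proj₁ b) → Graph._~_ (P k) (proj₁ (to a)) (proj₁ (to b))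
    to-~ a b j with i , l , c , x≡ , y≡ ← joins-path⁻ p j
      with refl ← UniqueP.lookup-injective u _ _ (trans (sym (position-lookup a)) x≡)
         | refl ← UniqueP.lookup-injective u _ _ (trans (sym (position-lookup b)) y≡) = toℕ<n i , toℕ<n l , c
    from-~ : ∀ a b → Graph._~_ (P k) (proj₁ (to a)) (proj₁ (to b)) → Joins (pathEdges p) (proj₁ a) (proj₁ b)
    from-~ a b (_ , _ , c) = subst₂ (Joins (pathEdges p)) (sym (position-lookup a)) (sym (position-lookup b))
      (joins-path⁺ p c)

-- Replaces an abstract isomorphism with `P k` by a sequence of labels. In this form the blocks of
-- an arbitrary design enter the computations with edge lists.
record Traces (G : Graph) (p : Path k) : Set where
  field
    simple  : Unique p
    vertex⁺ : ∀ i → lookup p i ∈ Graph.vertices G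
    edge⁺   : Joins (pathEdges p) x y → Graph._~_ G x y
    edge⁻   : Graph._~_ G x y → Joins (pathEdges p) x y

pathGraph-traces : (p : Path k) (u : Unique p) → Traces (pathGraph p u) p
pathGraph-traces p u = record
  { simple = u ; vertex⁺ = ∈-tabulate⁺ ; edge⁺ = id ; edge⁻ = id }

-- The inverse isomorphism, evaluated at 0, ..., k - 1, lists the vertices of `G` in path order.
trace : ∀ {G} → G ≅ᴳ P k → Σ[ p ∈ Path k ] Traces G p
trace {k} {G} (φ , adj) = Vec.tabulate h , record
  { simple  = UniqueP.tabulate⁺ h-injective
  ; vertex⁺ = λ i → subst (_∈ Graph.vertices G) (sym (lookup∘tabulate h i)) (proj₂ (place i))
  ; edge⁺   = edge⁺
  ; edge⁻   = edge⁻
  }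
  where
    open Inverse φ
    place : Fin k → Graph.Vertex G
    place i = from (toℕ i , ∈-upTo⁺ (toℕ<n i))
    h : Fin k → ℕ
    h = proj₁ ∘ place
    to-place : ∀ i → proj₁ (to (place i)) ≡ toℕ i
    to-place i = cong proj₁ (strictlyInverseˡ _)
    h-injective : ∀ {i j} → h i ≡ h j → i ≡ j
    h-injective {i} {j} eq = toℕ-injective (trans (sym (to-place i))
      (trans (cong (proj₁ ∘ to) (vertex-≡ G {place i} {place j} eq)) (to-place j)))
    position : ∀ a → ∃ λ i → proj₁ a ≡ h i
    position a with to a in eq
    ... | m , m∈ = fromℕ< (∈-upTo⁻ m∈) , cong proj₁ (trans (sym (strictlyInverseʳ a))
      (cong from (trans eq (vertex-≡ (P k) (sym (toℕ-fromℕ< (∈-upTo⁻ m∈)))))))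
    edge⁺ : ∀ {x y} → Joins (pathEdges (Vec.tabulate h)) x y → Graph._~_ G x y
    edge⁺ j with i , l , c , refl , refl ← joins-path⁻ (Vec.tabulate h) j =
      subst₂ (Graph._~_ G) (sym (lookup∘tabulate h i)) (sym (lookup∘tabulate h l))
        (Equivalence.from (adj (place i) (place l))
          (subst₂ (Graph._~_ (P k)) (sym (to-place i)) (sym (to-place l)) (toℕ<n i , toℕ<n l , c)))
    edge⁻ : ∀ {x y} → Graph._~_ G x y → Joins (pathEdges (Vec.tabulate h)) x y
    edge⁻ e with position (_ , Graph.incident G e) | position (_ , Graph.incident G (Graph.~-sym G e))
    ... | i , refl | l , refl
      -- The ends of the edge carry the membership proofs given by `incident`; `vertex-≡` exchanges
      -- them for those of `place`, about which `to-place` speaks.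
      with _ , _ , c ← subst₂ (Graph._~_ (P k)) (to-place i) (to-place l)
             (subst₂ (λ a b → Graph._~_ (P k) (proj₁ (to a)) (proj₁ (to b)))
               (vertex-≡ G {_ , _} {place i} refl) (vertex-≡ G {_ , _} {place l} refl)
               (Equivalence.to (adj (_ , Graph.incident G e) (_ , Graph.incident G (Graph.~-sym G e))) e)) =
      subst₂ (Joins (pathEdges (Vec.tabulate h))) (lookup∘tabulate h i) (lookup∘tabulate h l)
        (joins-path⁺ (Vec.tabulate h) c)

joins-++⁺ˡ : Joins E x y → Joins (E ++ F) x y
joins-++⁺ˡ = Sum.map ∈-++⁺ˡ ∈-++⁺ˡ

joins-++⁺ʳ : ∀ E → Joins F x y → Joins (E ++ F) x y
joins-++⁺ʳ E = Sum.map (∈-++⁺ʳ E) (∈-++⁺ʳ E)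

joins-≋ : E ≋ F → Joins E x y → Joins F x y
joins-≋ {x = x} {y} e j = mult≢0⇒joins (joins⇒mult≢0 j ∘ trans (at e x y))

joins-irrefl : ∀ {X} → ListUnique.Unique X → Joins (complete X) x y → x ≢ y
joins-irrefl u (inj₁ e∈) = go u e∈
  where
    go : ∀ {x y X} → ListUnique.Unique X → (x , y) ∈ complete X → x ≢ y
    go {X = z ∷ X} (z∉ ∷ u) e∈ with ∈-++⁻ (map (z ,_) X) e∈
    ... | inj₁ e∈ˡ with _ , y∈ , refl ← ∈-map⁻ (z ,_) e∈ˡ = All.lookup z∉ y∈
    ... | inj₂ e∈ʳ = go u e∈ʳ
joins-irrefl u (inj₂ e∈) = ≢-sym (joins-irrefl u (inj₁ e∈))

-- Designs as lists of paths

joins-edges⁺ : ∀ (Q : List (Path k)) i → Joins (pathEdges (List.lookup Q i)) x y → Joins (edges Q) x y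
joins-edges⁺ (p ∷ Q) zero    j = joins-++⁺ˡ j
joins-edges⁺ (p ∷ Q) (suc i) j = joins-++⁺ʳ (pathEdges p) (joins-edges⁺ Q i j)

mult≡1⇒∃! : ∀ (Q : List (Path k)) → mult (edges Q) x y ≡ 1 →
            ∃! _≡_ λ i → Joins (pathEdges (List.lookup Q i)) x y
mult≡1⇒∃! {x = x} {y} (p ∷ Q) eq with joins? (pathEdges p) x y
... | yes j = zero , j , unique
  where
    -- The first path already uses up the total multiplicity 1, which leaves 0 for the later ones.
    rest : mult (pathEdges p) x y ≢ 0 → mult (pathEdges p) x y + mult (edges Q) x y ≡ 1 → mult (edges Q) x y ≡ 0
    rest ne eq with mult (pathEdges p) x y
    ... | zero  = ⊥-elim (ne refl)
    ... | suc m = m+n≡0⇒n≡0 m (suc-injective eq)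
    unique : ∀ {i} → Joins (pathEdges (List.lookup (p ∷ Q) i)) x y → zero ≡ i
    unique {zero}  _ = refl
    unique {suc i} l = ⊥-elim (joins⇒mult≢0 (joins-edges⁺ Q i l)
      (rest (joins⇒mult≢0 j) (trans (sym (mult-++ (pathEdges p) (edges Q) x y)) eq)))
... | no ¬j with i , l , unique ← mult≡1⇒∃! Q (trans
        (cong (_+ mult (edges Q) x y) (sym (¬joins⇒mult≡0 (pathEdges p) ¬j)))
        (trans (sym (mult-++ (pathEdges p) (edges Q) x y)) eq)) =
    suc i , l , λ { {zero} j → ⊥-elim (¬j j) ; {suc _} l′ → cong suc (unique l′) }

¬joins⇒mult-edges≡0 : ∀ (f : Fin n → Path k) → (∀ i → ¬ Joins (pathEdges (f i)) x y) →
                      mult (edges (tabulate f)) x y ≡ 0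
¬joins⇒mult-edges≡0 {zero}          f ¬j = refl
¬joins⇒mult-edges≡0 {suc n} {_} {x} {y} f ¬j = trans (mult-++ (pathEdges (f zero)) _ x y)
  (cong₂ _+_ (¬joins⇒mult≡0 (pathEdges (f zero)) (¬j zero)) (¬joins⇒mult-edges≡0 (f ∘ suc) (¬j ∘ suc)))

∃!⇒mult≡1 : ∀ (f : Fin n → Path k) → (∀ i → Unique (f i)) →
            ∃! _≡_ (λ i → Joins (pathEdges (f i)) x y) → mult (edges (tabulate f)) x y ≡ 1
∃!⇒mult≡1 {suc n} {_} {x} {y} f u (zero , j , unique) = trans (mult-++ (pathEdges (f zero)) _ x y)
  (cong₂ _+_ (mult-path (u zero) j) (¬joins⇒mult-edges≡0 (f ∘ suc) λ i l → Fin.0≢1+n (unique l)))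
∃!⇒mult≡1 {suc n} {_} {x} {y} f u (suc i , j , unique) = trans (mult-++ (pathEdges (f zero)) _ x y)
  (cong₂ _+_ (¬joins⇒mult≡0 (pathEdges (f zero)) λ l → Fin.0≢1+n (sym (unique l)))
             (∃!⇒mult≡1 (f ∘ suc) (u ∘ suc) (i , j , λ l → Fin.suc-injective (unique l))))

-- With at least two vertices, every vertex of a path lies on an edge. Containment of the vertices
-- of a block thus follows from containment of its edges.
neighbour : ∀ (p : Path (2 + k)) i → ∃ λ y → Joins (pathEdges p) (lookup p i) y
neighbour p zero    = _ , joins-path⁺ p {zero} {suc zero} (inj₁ refl)
neighbour p (suc i) = _ , joins-path⁺ p {suc i} {inject₁ i} (inj₂ (cong suc (toℕ-inject₁ i)))

toDesign : ∀ (X : VertexSet) (Q : List (Path (2 + k))) → All Unique Q →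
           edges Q ≋ complete (VertexSet.elements X) → Design (K X) (P (2 + k))
toDesign {k} X Q u e = record
  { size       = length Q
  ; block      = block
  ; subgraph   = λ i → vertex i , λ j → proj₁ (inside i j) , proj₂ (inside i j) ,
                   λ x≡y → Graph.~-irrefl (block i) x≡y j
  ; isomorphic = λ i → pathGraph-≅ (List.lookup Q i) (simple i)
  ; partition  = λ (x∈ , y∈ , x≢y) → mult≡1⇒∃! Q (trans (at e _ _) (mult-complete X.unique x∈ y∈ x≢y))
  }
  where
    module X = VertexSet X
    simple : ∀ i → Unique (List.lookup Q i)
    simple i = All.lookup u (∈-lookup i)
    block : Fin (length Q) → Graph
    block i = pathGraph (List.lookup Q i) (simple i)
    inside : ∀ i {x y} → Joins (pathEdges (List.lookup Q i)) x y → x ∈ X.elements × y ∈ X.elements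
    inside i j = complete⁻ X.elements (joins-≋ e (joins-edges⁺ Q i j))
    vertex : ∀ i {x} → x ∈ tabulate (lookup (List.lookup Q i)) → x ∈ X.elements
    vertex i x∈ with j , refl ← ∈-tabulate⁻ {f = lookup (List.lookup Q i)} x∈ =
      proj₁ (inside i (proj₂ (neighbour (List.lookup Q i) j)))

module _ {X : VertexSet} (B : Design (K X) (P k)) where
  private
    module X = VertexSet X
    module B = Design B

  blockPath : Fin B.size → Path k
  blockPath i = proj₁ (trace {G = B.block i} (B.isomorphic i))

  blockPath-traces : ∀ i → Traces (B.block i) (blockPath i)
  blockPath-traces i = proj₂ (trace {G = B.block i} (B.isomorphic i))

  blockPaths : List (Path k)
  blockPaths = tabulate blockPath

  -- Conversely to `toDesign`, a design yields a list decomposition: on the edges of the complete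
  -- graph `partition` makes both multiplicities 1, and elsewhere `subgraph` makes both 0.
  edges-blockPaths : edges blockPaths ≋ complete X.elements
  edges-blockPaths = mk≋ go
    where
      module T i = Traces (blockPath-traces i)
      go : ∀ x y → mult (edges blockPaths) x y ≡ mult (complete X.elements) x y
      go x y with joins? (complete X.elements) x y
      ... | yes j = trans (∃!⇒mult≡1 blockPath T.simple
                            (i , T.edge⁻ i e , λ l → unique (T.edge⁺ _ l)))
                          (sym (mult-complete X.unique (proj₁ xy∈) (proj₂ xy∈) x≢y))
        where
          xy∈ = complete⁻ X.elements j
          x≢y = joins-irrefl X.unique j
          found = B.partition (proj₁ xy∈ , proj₂ xy∈ , x≢y)
          i = proj₁ found
          e = proj₁ (proj₂ found)
          unique = proj₂ (proj₂ found)
      ... | no ¬j = trans (¬joins⇒mult-edges≡0 blockPath λ i l →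
                             let x∈ , y∈ , x≢y = proj₂ (B.subgraph i) (T.edge⁺ i l) in ¬j (complete⁺ x∈ y∈ x≢y))
                          (sym (¬joins⇒mult≡0 (complete X.elements) ¬j))

-- Counting edges

∑ : List ℕ → (ℕ → ℕ) → ℕ
∑ X f = sum (map f X)

∑-cong : ∀ X {f g : ℕ → ℕ} → (∀ x → f x ≡ g x) → ∑ X f ≡ ∑ X g
∑-cong []      eq = refl
∑-cong (x ∷ X) eq = cong₂ _+_ (eq x) (∑-cong X eq)

∑-0 : ∀ X → ∑ X (λ _ → 0) ≡ 0
∑-0 []      = refl
∑-0 (x ∷ X) = ∑-0 X

∑-+ : ∀ X f g → ∑ X (λ x → f x + g x) ≡ ∑ X f + ∑ X g
∑-+ []      f g = refl
∑-+ (x ∷ X) f g = trans (cong (f x + g x +_) (∑-+ X f g))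
  (ℕ-solve 4 (λ a b c d → (a :+ b) :+ (c :+ d) := (a :+ c) :+ (b :+ d)) refl (f x) (g x) (∑ X f) (∑ X g))

∑-* : ∀ X c f → ∑ X (λ x → c * f x) ≡ c * ∑ X f
∑-* []      c f = sym (*-zeroʳ c)
∑-* (x ∷ X) c f = trans (cong (c * f x +_) (∑-* X c f)) (sym (*-distribˡ-+ c (f x) _))

∑-δ : ∀ {X p} → ListUnique.Unique X → p ∈ X → ∑ X (δ p) ≡ 1
∑-δ {z ∷ X} (z∉ ∷ u) (here refl) = cong₂ _+_ (δ-refl z) (none z∉)
  where
    none : ∀ {X} → All (z ≢_) X → ∑ X (δ z) ≡ 0
    none []         = refl
    none (z≢ ∷ z∉) = cong₂ _+_ (δ-≢ z≢) (none z∉)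
∑-δ {z ∷ X} (z∉ ∷ u) (there p∈) = cong₂ _+_ (δ-≢ (≢-sym (All.lookup z∉ p∈))) (∑-δ u p∈)

-- Double counting over ordered pairs: each edge within `X` contributes 2. This recovers the number
-- of edges from the multiplicities, which are all that `≋` retains.
total : List ℕ → List Edge → ℕ
total X E = ∑ X λ x → ∑ X (mult E x)

∑-product : ∀ X p q → ListUnique.Unique X → p ∈ X → q ∈ X → ∑ X (λ x → ∑ X λ y → δ p x * δ q y) ≡ 1
∑-product X p q u p∈ q∈ = trans (∑-cong X λ x → trans (∑-* X (δ p x) (δ q))
  (trans (cong (δ p x *_) (∑-δ u q∈)) (*-identityʳ (δ p x)))) (∑-δ u p∈)

total-hit : ∀ {X p q} → ListUnique.Unique X → p ∈ X → q ∈ X → ∑ X (λ x → ∑ X (hit (p , q) x)) ≡ 2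
total-hit {X} {p} {q} u p∈ q∈ = trans
  (∑-cong X λ x → trans (∑-+ X _ _) (cong (∑ X (λ y → δ p x * δ q y) +_) (∑-cong X λ y → *-comm (δ p y) _)))
  (trans (∑-+ X _ _) (cong₂ _+_ (∑-product X p q u p∈ q∈) (∑-product X q p u q∈ p∈)))

total-length : ∀ {X} → ListUnique.Unique X → ∀ E →
               (∀ {x y} → (x , y) ∈ E → x ∈ X × y ∈ X) → total X E ≡ length E * 2
total-length {X} u []            inside = trans (∑-cong X λ _ → ∑-0 X) (∑-0 X)
total-length {X} u ((p , q) ∷ E) inside = trans (trans (∑-cong X λ x → ∑-+ X _ _) (∑-+ X _ _))
  (cong₂ _+_ (Product.uncurry (total-hit u) (inside (here refl))) (total-length u E (inside ∘ there)))

-- The number n(n - 1)/2 of edges of $K_n$.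
triangular : ℕ → ℕ
triangular zero    = 0
triangular (suc n) = n + triangular n

length-complete : ∀ X → length (complete X) ≡ triangular (length X)
length-complete []      = refl
length-complete (x ∷ X) =
  trans (length-++ (map (x ,_) X)) (cong₂ _+_ (length-map (x ,_) X) (length-complete X))

≋-complete⇒length : ∀ {X} → ListUnique.Unique X → ∀ E → E ≋ complete X → length E ≡ triangular (length X)
≋-complete⇒length {X} u E e = trans (*-cancelʳ-≡ (length E) (length (complete X)) 2 (trans
  (sym (total-length u E (complete⁻ X ∘ joins-≋ e ∘ inj₁)))
  (trans (∑-cong X λ x → ∑-cong X (at e x)) (total-length u (complete X) (complete⁻ X ∘ inj₁)))))
  (length-complete X)

length-pathEdges : ∀ (p : Path (suc k)) → length (pathEdges p) ≡ k
length-pathEdges (x ∷ [])    = refl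
length-pathEdges (x ∷ y ∷ p) = cong suc (length-pathEdges (y ∷ p))

length-edges : ∀ (Q : List (Path (suc k))) → length (edges Q) ≡ length Q * k
length-edges []      = refl
length-edges (p ∷ Q) = trans (length-++ (pathEdges p)) (cong₂ _+_ (length-pathEdges p) (length-edges Q))

-- The increment appears as a multiple of 2, so the parity has period 4 in n; `triangular-3` gives
-- period 3 for the residues modulo 3 in the same way.
triangular-4 : ∀ n → triangular (4 + n) ≡ triangular n + (3 + n * 2) * 2
triangular-4 n = ℕ-solve 2 (λ n t → (con 3 :+ n) :+ ((con 2 :+ n) :+ ((con 1 :+ n) :+ (n :+ t)))
                          := t :+ (con 3 :+ n :* con 2) :* con 2) refl n (triangular n)

triangular-3 : ∀ n → triangular (3 + n) ≡ triangular n + (1 + n) * 3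
triangular-3 n = ℕ-solve 2 (λ n t → (con 2 :+ n) :+ ((con 1 :+ n) :+ (n :+ t)) := t :+ (con 1 :+ n) :* con 3)
  refl n (triangular n)

triangular-%2 : ∀ n → triangular (4 + n) % 2 ≡ triangular n % 2
triangular-%2 n = trans (cong (_% 2) (triangular-4 n)) ([m+kn]%n≡m%n (triangular n) (3 + n * 2) 2)

even-triangular⁻ : ∀ n → triangular n % 2 ≡ 0 → n % 4 ≡ 0 ⊎ n % 4 ≡ 1
even-triangular⁻ 0 eq = inj₁ refl
even-triangular⁻ 1 eq = inj₂ refl
even-triangular⁻ (suc (suc (suc (suc n)))) eq = even-triangular⁻ n (trans (sym (triangular-%2 n)) eq)

even-triangular⁺ : ∀ n → n % 4 ≡ 0 ⊎ n % 4 ≡ 1 → triangular n % 2 ≡ 0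
even-triangular⁺ 0 r = refl
even-triangular⁺ 1 r = refl
even-triangular⁺ 2 (inj₁ ())
even-triangular⁺ 2 (inj₂ ())
even-triangular⁺ 3 (inj₁ ())
even-triangular⁺ 3 (inj₂ ())
even-triangular⁺ (suc (suc (suc (suc n)))) r = trans (triangular-%2 n) (even-triangular⁺ n r)

triangular-%3 : ∀ n → triangular n % 3 ≡ 0 → n % 3 ≢ 2
triangular-%3 0 _ ()
triangular-%3 1 _ ()
triangular-%3 2 ()
triangular-%3 (suc (suc (suc n))) eq = triangular-%3 n
  (trans (sym (trans (cong (_% 3) (triangular-3 n)) ([m+kn]%n≡m%n (triangular n) (1 + n) 3))) eq)

-- Decomposing a graph with a dominating vertex into copies of P₃

pairUp : ∀ u qs → Σ[ T ∈ List (Path 3) ]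
  (edges T ≋ map (u ,_) qs ⊎ ∃ λ q → (u , q) ∷ edges T ≋ map (u ,_) qs)
pairUp u []            = [] , inj₁ ≋-refl
pairUp u (q ∷ [])      = [] , inj₂ (q , ≋-refl)
pairUp u (q ∷ q′ ∷ qs) with pairUp u qs
... | T , inj₁ e       = path₃ q u q′ ∷ T , inj₁ (++-cong (flip-≋ q u) (++-cong (≋-refl {(u , q′) ∷ []}) e))
... | T , inj₂ (r , e) = path₃ q u q′ ∷ T , inj₂ (r , (begin
  (u , r) ∷ (q , u) ∷ (u , q′) ∷ edges T
    ≈⟨ solve 4 (λ a b c d → a ⊕ (b ⊕ (c ⊕ d)) ⊜ b ⊕ (c ⊕ (a ⊕ d))) ≋-refl
         ((u , r) ∷ []) ((q , u) ∷ []) ((u , q′) ∷ []) (edges T) ⟩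
  (q , u) ∷ (u , q′) ∷ (u , r) ∷ edges T
    ≈⟨ ++-cong (flip-≋ q u) (++-cong (≋-refl {(u , q′) ∷ []}) e) ⟩
  map (u ,_) (q ∷ q′ ∷ qs) ∎))

splitFirst : ∀ u U Es → All ((_∈ u ∷ U) ∘ proj₁) Es →
  Σ[ qs ∈ List ℕ ] Σ[ Es′ ∈ List Edge ] (All ((_∈ U) ∘ proj₁) Es′ × map (u ,_) qs ++ Es′ ≋ Es)
splitFirst u U []             []         = [] , [] , [] , ≋-refl
splitFirst u U ((p , q) ∷ Es) (p∈ ∷ Es∈) with splitFirst u U Es Es∈
splitFirst u U ((p , q) ∷ Es) (here refl ∷ Es∈) | qs , Es′ , Es′∈ , e =
  q ∷ qs , Es′ , Es′∈ , ++-cong (≋-refl {(u , q) ∷ []}) e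
splitFirst u U ((p , q) ∷ Es) (there p∈ ∷ Es∈) | qs , Es′ , Es′∈ , e =
  qs , (p , q) ∷ Es′ , p∈ ∷ Es′∈ , (begin
    map (u ,_) qs ++ (p , q) ∷ Es′
      ≈⟨ solve 3 (λ a b c → a ⊕ (b ⊕ c) ⊜ b ⊕ (a ⊕ c)) ≋-refl (map (u ,_) qs) ((p , q) ∷ []) Es′ ⟩
    (p , q) ∷ map (u ,_) qs ++ Es′
      ≈⟨ ++-cong (≋-refl {(p , q) ∷ []}) e ⟩
    (p , q) ∷ Es ∎)

-- Every edge of `Es` is charged to its first endpoint, and each u in `U` holds the edge wu in
-- reserve. The reserve is spent exactly when the number of edges charged to u is odd; `R` collects
-- the ends of the unspent ones.
star : ∀ w U Es → All ((_∈ U) ∘ proj₁) Es →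
  Σ[ T ∈ List (Path 3) ] Σ[ R ∈ List ℕ ] (edges T ++ map (w ,_) R ≋ Es ++ map (w ,_) U)
star w []      []       Es∈        = [] , [] , ≋-refl
star w []      (e ∷ Es) (() ∷ Es∈)
star w (u ∷ U) Es       Es∈ with splitFirst u U Es Es∈
... | qs , Es′ , Es′∈ , e with star w U Es′ Es′∈ | pairUp u qs
... | T , R , f | T′ , inj₁ g = T′ ++ T , u ∷ R , (begin
  edges (T′ ++ T) ++ (w , u) ∷ map (w ,_) R
    ≡⟨ cong (_++ (w , u) ∷ map (w ,_) R) (edges-++ T′ T) ⟩
  (edges T′ ++ edges T) ++ (w , u) ∷ map (w ,_) R
    ≈⟨ solve 4 (λ a b c d → (a ⊕ b) ⊕ (c ⊕ d) ⊜ (a ⊕ c) ⊕ (b ⊕ d)) ≋-refl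
         (edges T′) (edges T) ((w , u) ∷ []) (map (w ,_) R) ⟩
  (edges T′ ++ (w , u) ∷ []) ++ edges T ++ map (w ,_) R
    ≈⟨ ++-cong (++-cong g ≋-refl) f ⟩
  (map (u ,_) qs ++ (w , u) ∷ []) ++ Es′ ++ map (w ,_) U
    ≈⟨ solve 4 (λ a b c d → (a ⊕ b) ⊕ (c ⊕ d) ⊜ (a ⊕ c) ⊕ (b ⊕ d)) ≋-refl
         (map (u ,_) qs) ((w , u) ∷ []) Es′ (map (w ,_) U) ⟩
  (map (u ,_) qs ++ Es′) ++ (w , u) ∷ map (w ,_) U
    ≈⟨ ++-cong e ≋-refl ⟩
  Es ++ map (w ,_) (u ∷ U) ∎)
-- Odd case: the edge uq left over is joined to the reserve edge at `u`.
... | T , R , f | T′ , inj₂ (q , g) = path₃ q u w ∷ T′ ++ T , R , (begin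
  ((q , u) ∷ (u , w) ∷ edges (T′ ++ T)) ++ map (w ,_) R
    ≡⟨ cong (λ E → ((q , u) ∷ (u , w) ∷ E) ++ map (w ,_) R) (edges-++ T′ T) ⟩
  ((q , u) ∷ (u , w) ∷ (edges T′ ++ edges T)) ++ map (w ,_) R
    ≈⟨ solve 5 (λ a b c d e → (a ⊕ (b ⊕ (c ⊕ d))) ⊕ e ⊜ (a ⊕ c) ⊕ (b ⊕ (d ⊕ e))) ≋-refl
         ((q , u) ∷ []) ((u , w) ∷ []) (edges T′) (edges T) (map (w ,_) R) ⟩
  ((q , u) ∷ edges T′) ++ (u , w) ∷ edges T ++ map (w ,_) R
    ≈⟨ ++-cong (++-cong (flip-≋ q u) (≋-refl {edges T′})) (++-cong (flip-≋ u w) f) ⟩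
  ((u , q) ∷ edges T′) ++ (w , u) ∷ Es′ ++ map (w ,_) U
    ≈⟨ ++-cong g ≋-refl ⟩
  map (u ,_) qs ++ (w , u) ∷ Es′ ++ map (w ,_) U
    ≈⟨ solve 4 (λ a b c d → a ⊕ (b ⊕ (c ⊕ d)) ⊜ (a ⊕ c) ⊕ (b ⊕ d)) ≋-refl
         (map (u ,_) qs) ((w , u) ∷ []) Es′ (map (w ,_) U) ⟩
  (map (u ,_) qs ++ Es′) ++ (w , u) ∷ map (w ,_) U
    ≈⟨ ++-cong e ≋-refl ⟩
  Es ++ map (w ,_) (u ∷ U) ∎)

completeP₃ : ∀ {Y} → ListUnique.Unique Y → length Y % 4 ≡ 0 ⊎ length Y % 4 ≡ 1 →
  ∀ (R : List (Path 3)) w U Es → All ((_∈ U) ∘ proj₁) Es →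
  edges R ++ Es ++ map (w ,_) U ≋ complete Y →
  Σ[ T ∈ List (Path 3) ] edges (R ++ T) ≋ complete Y
completeP₃ {Y} u r R w U Es Es∈ e with star w U Es Es∈
... | T , S , f with pairUp w S
... | T′ , inj₁ g = T ++ T′ , (begin
  edges (R ++ T ++ T′)             ≡⟨ trans (edges-++ R _) (cong (edges R ++_) (edges-++ T T′)) ⟩
  edges R ++ edges T ++ edges T′   ≈⟨ ++-cong (≋-refl {edges R}) (++-cong (≋-refl {edges T}) g) ⟩
  edges R ++ edges T ++ map (w ,_) S ≈⟨ ++-cong (≋-refl {edges R}) f ⟩
  edges R ++ Es ++ map (w ,_) U    ≈⟨ e ⟩
  complete Y                       ∎)
-- An edge left over at `w` would make the number of edges of the complete graph odd: one plus twice
-- the number of P₃s.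
... | T′ , inj₂ (q , g) = ⊥-elim (odd≢even (≋-complete⇒length u ((w , q) ∷ edges (R ++ T ++ T′)) (begin
  (w , q) ∷ edges (R ++ T ++ T′)
    ≡⟨ cong ((w , q) ∷_) (trans (edges-++ R _) (cong (edges R ++_) (edges-++ T T′))) ⟩
  (w , q) ∷ edges R ++ edges T ++ edges T′
    ≈⟨ solve 4 (λ a b c d → a ⊕ (b ⊕ (c ⊕ d)) ⊜ b ⊕ (c ⊕ (a ⊕ d))) ≋-refl
         ((w , q) ∷ []) (edges R) (edges T) (edges T′) ⟩
  edges R ++ edges T ++ (w , q) ∷ edges T′
    ≈⟨ ++-cong (≋-refl {edges R}) (++-cong (≋-refl {edges T}) g) ⟩
  edges R ++ edges T ++ map (w ,_) S
    ≈⟨ ++-cong (≋-refl {edges R}) f ⟩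
  edges R ++ Es ++ map (w ,_) U
    ≈⟨ e ⟩
  complete Y ∎)))
  where
    odd≢even : suc (length (edges (R ++ T ++ T′))) ≢ triangular (length Y)
    odd≢even eq with () ← trans (sym ([m+kn]%n≡m%n 1 (length (R ++ T ++ T′)) 2))
      (trans (cong (_% 2) (trans (cong suc (sym (length-edges (R ++ T ++ T′)))) eq))
             (even-triangular⁺ (length Y) r))

-- Links between list designs

mult-∈ : ∀ {Q : List (Path k)} {p} → p ∈ Q → ∀ x y → mult (pathEdges p) x y ≤ mult (edges Q) x y
mult-∈ {Q = p ∷ Q} (here refl) x y =
  subst (mult (pathEdges p) x y ≤_) (sym (mult-++ (pathEdges p) (edges Q) x y)) (m≤m+n _ _)
mult-∈ {Q = q ∷ Q} (there p∈)  x y =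
  subst (_ ≤_) (sym (mult-++ (pathEdges q) (edges Q) x y)) (≤-trans (mult-∈ p∈ x y) (m≤n+m _ _))

joins-∈ : ∀ {Q : List (Path k)} {p} → p ∈ Q → Joins (pathEdges p) x y → Joins (edges Q) x y
joins-∈ {Q = Q} p∈ j = subst (λ p → Joins (pathEdges p) _ _ → Joins (edges Q) _ _) (sym (lookup-index p∈))
  (joins-edges⁺ Q (index p∈)) j

-- If the two ends coincided, the path would run through one edge twice, whereas the complete graph
-- contains it once.
P₃-simple : ∀ {Y} → ListUnique.Unique Y → (R : List (Path 3)) → edges R ≋ complete Y → All Unique R
P₃-simple {Y} u R e = All.tabulate (λ {p} → simple p)
  where
    distinct : ∀ {p x y} → p ∈ R → Joins (pathEdges p) x y → x ≢ y
    distinct p∈ j = joins-irrefl u (joins-≋ e (joins-∈ p∈ j))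
    simple : ∀ p → p ∈ R → Unique p
    simple (a ∷ b ∷ c ∷ []) p∈ = (a≢b ∷ a≢c ∷ []) ∷ (b≢c ∷ []) ∷ [] ∷ []
      where
        a≢b = distinct p∈ (inj₁ (here refl))
        b≢c = distinct p∈ (inj₁ (there (here refl)))
        a≢c : a ≢ c
        a≢c refl = 1+n≰n (subst₂ _≤_ twice once (mult-∈ p∈ a b))
          where
            twice : mult (pathEdges (path₃ a b a)) a b ≡ 2
            twice = cong₂ _+_ (hit-≡ a≢b) (cong (_+ 0) (trans (hit-comm (b , a) a b) (hit-≡ b≢c)))
            once : mult (edges R) a b ≡ 1
            once = trans (at e a b) (let a∈ , b∈ = complete⁻ Y (joins-≋ e (joins-∈ p∈ (inj₁ (here refl))))
                                     in mult-complete u a∈ b∈ a≢b)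

front-≤ᴳ : ∀ (q : Path 4) (r : Path 3) u u′ → r ≡ front q → pathGraph r u′ ≤ᴳ pathGraph q u
front-≤ᴳ q@(a ∷ b ∷ c ∷ d ∷ []) _ u u′ refl = vertex , Sum.map widen widen
  where
    vertex : ∀ {x} → x ∈ a ∷ b ∷ c ∷ [] → x ∈ a ∷ b ∷ c ∷ d ∷ []
    vertex = ∈-++⁺ˡ
    widen : ∀ {e} → e ∈ (a , b) ∷ (b , c) ∷ [] → e ∈ (a , b) ∷ (b , c) ∷ (c , d) ∷ []
    widen = ∈-++⁺ˡ

-- The down-link sends each block to the index of its initial P₃. Only the P₄s are assumed simple;
-- for the P₃s this follows from the decomposition.
linkLists : ∀ (X Y : VertexSet) Q T → All Unique Q → edges Q ≋ complete (VertexSet.elements X) →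
            edges (map front Q ++ T) ≋ complete (VertexSet.elements Y) →
            𝓛₁ (P 4) (VertexSet.order X) (VertexSet.order Y)
linkLists X Y Q T u e f =
  record { vertexSet = X ; order≡n = refl ; design = toDesign X Q u e } ,
  record { vertexSet = Y ; order≡n = refl ; design = toDesign Y R simple f } ,
  (λ i → index (front∈ i)) ,
  λ i → front-≤ᴳ (List.lookup Q i) (List.lookup R (index (front∈ i))) (All.lookup u (∈-lookup {xs = Q} i))
          (All.lookup simple (∈-lookup (index (front∈ i)))) (sym (lookup-index (front∈ i)))
  where
    R = map front Q ++ T
    simple : All Unique R
    simple = P₃-simple (VertexSet.unique Y) R f
    front∈ : ∀ i → front (List.lookup Q i) ∈ R
    front∈ i = ∈-++⁺ˡ {xs = map front Q} (∈-map⁺ front (∈-lookup {xs = Q} i))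

range-≥ : ∀ o l → All (o ≤_) (range o l)
range-≥ o zero    = []
range-≥ o (suc l) = ≤-refl ∷ All.map (≤-trans (n≤1+n o)) (range-≥ (suc o) l)

range-unique : ∀ o l → ListUnique.Unique (range o l)
range-unique o zero    = []
range-unique o (suc l) = All.map <⇒≢ (range-≥ (suc o) l) ∷ range-unique (suc o) l

length-range : ∀ o l → length (range o l) ≡ l
length-range o zero    = refl
length-range o (suc l) = cong suc (length-range (suc o) l)

rangeSet : ℕ → ℕ → VertexSet
rangeSet o l = record { elements = range o l ; unique = range-unique o l }

back : Path 4 → Edge
back (a ∷ b ∷ c ∷ d ∷ []) = c , d

edges-front-back : ∀ Q → edges Q ≋ edges (map front Q) ++ map back Q
edges-front-back []                           = ≋-refl
edges-front-back ((a ∷ b ∷ c ∷ d ∷ []) ∷ Q) = begin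
  ((a , b) ∷ (b , c) ∷ []) ++ (c , d) ∷ edges Q
    ≈⟨ ++-cong (≋-refl {(a , b) ∷ (b , c) ∷ []}) (++-cong (≋-refl {(c , d) ∷ []}) (edges-front-back Q)) ⟩
  ((a , b) ∷ (b , c) ∷ []) ++ (c , d) ∷ edges (map front Q) ++ map back Q
    ≈⟨ solve 4 (λ a b c d → a ⊕ (b ⊕ (c ⊕ d)) ⊜ (a ⊕ c) ⊕ (b ⊕ d)) ≋-refl
         ((a , b) ∷ (b , c) ∷ []) ((c , d) ∷ []) (edges (map front Q)) (map back Q) ⟩
  (((a , b) ∷ (b , c) ∷ []) ++ edges (map front Q)) ++ (c , d) ∷ map back Q ∎

∈⇒≤sum : ∀ {X x} → x ∈ X → x ≤ sum X
∈⇒≤sum {z ∷ X} (here refl) = m≤m+n z _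
∈⇒≤sum {z ∷ X} (there x∈)  = ≤-trans (∈⇒≤sum x∈) (m≤n+m _ z)

product-first : ∀ (xs ys : List ℕ) → All ((_∈ xs) ∘ proj₁) (cartesianProduct xs ys)
product-first xs ys = All.tabulate (proj₁ ∘ ∈-cartesianProduct⁻ xs ys)

linkLarger : ∀ X Q → All Unique Q → edges Q ≋ complete (VertexSet.elements X) →
             ∀ m → (suc m + VertexSet.order X) % 4 ≡ 0 ⊎ (suc m + VertexSet.order X) % 4 ≡ 1 →
             𝓛₁ (P 4) (VertexSet.order X) (suc m + VertexSet.order X)
linkLarger X Q u e m r = subst (𝓛₁ (P 4) (VertexSet.order X)) order
  (linkLists X Y Q (proj₁ T) u e (proj₂ T))
  where
    V = VertexSet.elements X
    -- Exceeds every label in `V`, so this label and all later ones are new.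
    w = suc (sum V)
    N = range (suc w) m
    Z = N ++ V
    order : length (w ∷ Z) ≡ suc m + length V
    order = cong suc (trans (length-++ N) (cong (_+ length V) (length-range (suc w) m)))
    fresh : ∀ {x} → w ≤ x → x ∉ V
    fresh w≤x x∈ = <⇒≱ w≤x (∈⇒≤sum x∈)
    Y : VertexSet
    Y = record
      { elements = w ∷ Z
      ; unique   = ListUniqueP.++⁺ (range-unique w (suc m)) (VertexSet.unique X)
          λ (x∈ , x∈V) → fresh (All.lookup (range-≥ w (suc m)) x∈) x∈V
      }
    -- All edges that are neither in an initial P₃ nor at `w`. Each starts in `Z`, as charging edges
    -- to their first endpoints requires.
    Es = map back Q ++ complete N ++ cartesianProduct N V
    Es-first : All ((_∈ Z) ∘ proj₁) Es
    Es-first = AllP.++⁺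
      (All.tabulate λ e∈ → ∈-++⁺ʳ N (proj₁ (complete⁻ V (joins-≋ e (joins-≋ (≋-sym (edges-front-back Q))
        (joins-++⁺ʳ (edges (map front Q)) (inj₁ e∈)))))))
      (AllP.++⁺ (All.tabulate λ e∈ → ∈-++⁺ˡ (proj₁ (∈complete⁻ N e∈)))
                (All.map (λ p∈ → ∈-++⁺ˡ p∈) (product-first N V)))
    T : Σ[ T ∈ List (Path 3) ] edges (map front Q ++ T) ≋ complete (w ∷ Z)
    T = completeP₃ (VertexSet.unique Y) (subst (λ n → n % 4 ≡ 0 ⊎ n % 4 ≡ 1) (sym order) r)
          (map front Q) w Z Es Es-first (begin
      edges (map front Q) ++ (map back Q ++ complete N ++ cartesianProduct N V) ++ map (w ,_) Z
        ≈⟨ solve 5 (λ a b c d e → a ⊕ ((b ⊕ (c ⊕ d)) ⊕ e) ⊜ e ⊕ (c ⊕ (d ⊕ (a ⊕ b)))) ≋-refl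
             (edges (map front Q)) (map back Q) (complete N) (cartesianProduct N V) (map (w ,_) Z) ⟩
      map (w ,_) Z ++ complete N ++ cartesianProduct N V ++ edges (map front Q) ++ map back Q
        ≈⟨ ++-cong (≋-refl {map (w ,_) Z}) (++-cong (≋-refl {complete N}) (++-cong (≋-refl {cartesianProduct N V})
             (≋-trans (≋-sym (edges-front-back Q)) e))) ⟩
      map (w ,_) Z ++ complete N ++ cartesianProduct N V ++ complete V
        ≈⟨ ++-cong (≋-refl {map (w ,_) Z}) (complete-++ N V) ⟨
      complete (w ∷ Z) ∎)

-- Families of designs

PlainLinked : ℕ → Set
PlainLinked v = (∃ λ k → v ≡ double k × Linked [] 0 k) ⊎ (∃ λ k → v ≡ suc (double k) × Linked (0 ∷ []) 1 k)

-- The two conditions leave the residues 0, 1, 4 and 9 modulo 12. Twelve is the common period of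
-- both, so the recursion adds twelve vertices; orders 0 and 1 start it with empty decompositions.
plainLinked : ∀ v → v % 3 ≢ 2 → v % 4 ≡ 0 ⊎ v % 4 ≡ 1 → PlainLinked v
plainLinked 0  _ _ = inj₁ (0 , refl , linked [] [] refl refl)
plainLinked 1  _ _ = inj₂ (0 , refl , linked [] [] refl refl)
plainLinked 2  p _ = ⊥-elim (p refl)
plainLinked 3  _ (inj₁ ())
plainLinked 3  _ (inj₂ ())
plainLinked 4  _ _ = inj₁ (2 , refl , linked plain4-Q plain4-T refl refl)
plainLinked 5  p _ = ⊥-elim (p refl)
plainLinked 6  _ (inj₁ ())
plainLinked 6  _ (inj₂ ())
plainLinked 7  _ (inj₁ ())
plainLinked 7  _ (inj₂ ())
plainLinked 8  p _ = ⊥-elim (p refl)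
plainLinked 9  _ _ = inj₂ (4 , refl , linked plain9-Q plain9-T refl refl)
plainLinked 10 _ (inj₁ ())
plainLinked 10 _ (inj₂ ())
plainLinked 11 p _ = ⊥-elim (p refl)
plainLinked (suc (suc (suc (suc (suc (suc (suc (suc (suc (suc (suc (suc v)))))))))))) p q =
  Sum.map (λ (k , eq , L) → 6 + k , cong (12 +_) eq , extendLinked plainEven L)
          (λ (k , eq , L) → 6 + k , cong (12 +_) eq , extendLinked plainOdd L) (plainLinked v p q)

PointedLinked : ℕ → Set
PointedLinked n = (∃ λ k → n ≡ double k × Linked [] 1 k) ⊎ (∃ λ k → n ≡ suc (double k) × Linked (1 ∷ []) 2 k)

-- Here n = v - 1, and the residues 0, 5, 8 and 9 of n modulo 12 remain. The step is named after the
-- parity of v, so even n calls for `pointedOdd`.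
pointedLinked : ∀ n → suc n % 3 ≢ 2 → n % 4 ≡ 0 ⊎ n % 4 ≡ 1 → PointedLinked n
pointedLinked 0  _ _ = inj₁ (0 , refl , linked [] [] refl refl)
pointedLinked 1  p _ = ⊥-elim (p refl)
pointedLinked 2  _ (inj₁ ())
pointedLinked 2  _ (inj₂ ())
pointedLinked 3  _ (inj₁ ())
pointedLinked 3  _ (inj₂ ())
pointedLinked 4  p _ = ⊥-elim (p refl)
pointedLinked 5  _ _ = inj₂ (2 , refl , linked pointed6-Q pointed6-T refl refl)
pointedLinked 6  _ (inj₁ ())
pointedLinked 6  _ (inj₂ ())
pointedLinked 7  p _ = ⊥-elim (p refl)
pointedLinked 8  _ _ = inj₁ (4 , refl , linked pointed9-Q pointed9-T refl refl)
pointedLinked 9  _ _ = inj₂ (4 , refl , linked pointed10-Q pointed10-T refl refl)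
pointedLinked 10 p _ = ⊥-elim (p refl)
pointedLinked 11 _ (inj₁ ())
pointedLinked 11 _ (inj₂ ())
pointedLinked (suc (suc (suc (suc (suc (suc (suc (suc (suc (suc (suc (suc n)))))))))))) p q =
  Sum.map (λ (k , eq , L) → 6 + k , cong (12 +_) eq , extendLinked pointedOdd L)
          (λ (k , eq , L) → 6 + k , cong (12 +_) eq , extendLinked pointedEven L) (pointedLinked n p q)

record Interior (s k : ℕ) : Set where
  field
    Q        : List (Path 4)
    simple   : All Unique Q
    full     : edges Q ≋ complete (range 0 s ++ range s (double k))
    interior : All (_∈ middles Q) (range 0 s ++ range s (double k))

-- Old vertices remain inner vertices of old blocks, and the new ones are inner vertices of the
-- relabelled copies of the paths in `G`.
extendInterior : ∀ {A s k} (S : LinkedStep A s) → All (_∈ middles (LinkedStep.G S)) (range s 12) →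
               Interior s k → Interior s (6 + k)
extendInterior {A} {s} {k} S mid D = record
  { Q        = Q′
  ; simple   = All-extend⁺ s k S.simple pair-simple D.simple
  ; full     = extend-complete (range 0 s) s k S.G pair-Q D.Q S.fixed₀ S.full refl D.full
  ; interior = AllP.++⁺ (All.map old (AllP.++⁻ˡ (range 0 s) D.interior))
      (subst (All (_∈ middles Q′)) joined
        (AllP.++⁺ (All.map old (AllP.++⁻ʳ (range 0 s) D.interior)) (All.tabulate new)))
  }
  where
    module S = LinkedStep S
    module D = Interior D
    φ = raise s (double k)
    G′ = map (Vec.map φ) S.G
    R = fan s k pair-Q
    Q′ = extend s k S.G pair-Q D.Q
    middles-Q′ : middles Q′ ≡ middles D.Q ++ middles G′ ++ middles R
    middles-Q′ = trans (concatMap-++ _ D.Q _) (cong (middles D.Q ++_) (concatMap-++ _ G′ R))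
    old : ∀ {x} → x ∈ middles D.Q → x ∈ middles Q′
    old x∈ = subst (_ ∈_) (sym middles-Q′) (∈-++⁺ˡ x∈)
    new : ∀ {x} → x ∈ range (double k + s) 12 → x ∈ middles Q′
    new {x} x∈ with i , i∈ , refl ← ∈-map⁻ φ (subst (x ∈_) (sym (map-raise-range s (double k) 0 12)) x∈) =
      subst (_ ∈_) (sym middles-Q′) (∈-++⁺ʳ (middles D.Q) (∈-++⁺ˡ
        (subst (φ i ∈_) (sym (middles-map φ S.G)) (∈-map⁺ φ (All.lookup mid i∈)))))
    joined : range s (double k) ++ range (double k + s) 12 ≡ range s (double (6 + k))
    joined = trans (sym (range-++ s (double k) 12)) (cong (range s) (+-comm (double k) 12))

interior? : ∀ Q V → Dec (All (_∈ middles Q) V)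
interior? Q = All.all? λ x → _∈?_ _≟_ x (middles Q)

InteriorOrder : ℕ → Set
InteriorOrder v = (∃ λ k → v ≡ double k × Interior 0 k) ⊎ (∃ λ k → v ≡ suc (double k) × Interior 1 k)

interiorDesign : ∀ {s k} Q → {True (simple? Q)} → {True (interior? Q (range 0 s ++ range s (double k)))} →
               canon (edges Q) ≡ canon (complete (range 0 s ++ range s (double k))) → Interior s k
interiorDesign Q {u} {i} f = record
  { Q = Q ; simple = toWitness u ; full = canon-id (edges Q) _ f ; interior = toWitness i }

-- For v = 2 + n only the case in which v - 1 is a possible order of a P₃-design matters, which
-- leaves v congruent to 1, 6, 9 or 10 modulo 12. The single vertex of order 1 lies in no block, so
-- the residue 1 starts at 13.
interiorOrder : ∀ n → (2 + n) % 3 ≢ 2 → suc n % 4 ≡ 0 ⊎ suc n % 4 ≡ 1 → InteriorOrder (2 + n)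
interiorOrder 0  p _ = ⊥-elim (p refl)
interiorOrder 1  _ (inj₁ ())
interiorOrder 1  _ (inj₂ ())
interiorOrder 2  _ (inj₁ ())
interiorOrder 2  _ (inj₂ ())
interiorOrder 3  p _ = ⊥-elim (p refl)
interiorOrder 4  _ _ = inj₁ (3 , refl , interiorDesign interior6-Q refl)
interiorOrder 5  _ (inj₁ ())
interiorOrder 5  _ (inj₂ ())
interiorOrder 6  p _ = ⊥-elim (p refl)
interiorOrder 7  _ _ = inj₂ (4 , refl , interiorDesign plain9-Q refl)
interiorOrder 8  _ _ = inj₁ (5 , refl , interiorDesign interior10-Q refl)
interiorOrder 9  p _ = ⊥-elim (p refl)
interiorOrder 10 _ (inj₁ ())
interiorOrder 10 _ (inj₂ ())
interiorOrder 11 _ _ = inj₂ (6 , refl , interiorDesign plain13-Q refl)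
interiorOrder (suc (suc (suc (suc (suc (suc (suc (suc (suc (suc (suc (suc n)))))))))))) p q =
  Sum.map (λ (k , eq , D) → 6 + k , cong (12 +_) eq ,
             extendInterior plainEven (from-yes (interior? plain12-Q (range 0 12))) D)
          (λ (k , eq , D) → 6 + k , cong (12 +_) eq ,
             extendInterior plainOdd (from-yes (interior? plain13-Q (range 1 12))) D)
          (interiorOrder n p q)

range-𝓛₁ : ∀ v o n Q T → All Unique Q → edges Q ≋ complete (range 0 v) →
           edges (map front Q ++ T) ≋ complete (range o n) → 𝓛₁ (P 4) v n
range-𝓛₁ v o n Q T u e f = subst₂ (𝓛₁ (P 4)) (length-range 0 v) (length-range o n)
  (linkLists (rangeSet 0 v) (rangeSet o n) Q T u e f)

plainLinked⇒𝓛₁ : PlainLinked v → 𝓛₁ (P 4) v v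
plainLinked⇒𝓛₁ (inj₁ (k , refl , L)) = range-𝓛₁ _ 0 _ L.Q L.T L.simple L.full L.link
  where module L = Linked L
plainLinked⇒𝓛₁ (inj₂ (k , refl , L)) = range-𝓛₁ _ 0 _ L.Q L.T L.simple L.full L.link
  where module L = Linked L

pointedLinked⇒𝓛₁ : PointedLinked n → 𝓛₁ (P 4) (suc n) n
pointedLinked⇒𝓛₁ (inj₁ (k , refl , L)) = range-𝓛₁ _ 1 _ L.Q L.T L.simple L.full L.link
  where module L = Linked L
pointedLinked⇒𝓛₁ (inj₂ (k , refl , L)) = range-𝓛₁ _ 1 _ L.Q L.T L.simple L.full L.link
  where module L = Linked L

-- Necessary conditions

triangular-order : (B : DesignOfOrder (P (suc k)) n) → ∃ λ t → triangular n ≡ t * k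
triangular-order record { vertexSet = X ; order≡n = refl ; design = D } = length (blockPaths D) , trans
  (sym (≋-complete⇒length (VertexSet.unique X) _ (edges-blockPaths D))) (length-edges (blockPaths D))

order-P₄ : DesignOfOrder (P 4) v → v % 3 ≢ 2
order-P₄ {v} B with t , eq ← triangular-order B = triangular-%3 v (trans (cong (_% 3) eq) (m*n%n≡0 t 3))

order-P₃ : DesignOfOrder (P 3) n → n % 4 ≡ 0 ⊎ n % 4 ≡ 1
order-P₃ {n} B with t , eq ← triangular-order B = even-triangular⁻ n (trans (cong (_% 2) eq) (m*n%n≡0 t 2))

Middle : Fin 4 → Set
Middle m = m ≡ 1F ⊎ m ≡ 2F

middle? : ∀ m → Dec (Middle m)
middle? m = (m Fin.≟ 1F) ⊎-dec (m Fin.≟ 2F)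

consecutive? : ∀ (i j : Fin k) → Dec (Consecutive i j)
consecutive? i j = (suc (toℕ i) ≟ toℕ j) ⊎-dec (suc (toℕ j) ≟ toℕ i)

-- A P₃ occupies the positions 0, 1, 2 or 1, 2, 3 of the P₄; the finitely many cases are decided by
-- evaluation.
P₃-covers-middle : ∀ (i j l m : Fin 4) → Consecutive i j → Consecutive j l → i ≢ l → Middle m →
                   m ≡ i ⊎ m ≡ j ⊎ m ≡ l
P₃-covers-middle = from-yes (Fin.all? λ i → Fin.all? λ j → Fin.all? λ l → Fin.all? λ m →
  consecutive? i j →-dec (consecutive? j l →-dec (¬? (i Fin.≟ l) →-dec (middle? m →-dec
    ((m Fin.≟ i) ⊎-dec ((m Fin.≟ j) ⊎-dec (m Fin.≟ l)))))))

edge-meets-middle : ∀ (i j : Fin 4) → Consecutive i j → Middle i ⊎ Middle j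
edge-meets-middle = from-yes (Fin.all? λ i → Fin.all? λ j → consecutive? i j →-dec (middle? i ⊎-dec middle? j))

middle-∈ : ∀ {G H} {p : Path 4} {r : Path 3} → Traces G p → Traces H r → H ≤ᴳ G →
           ∀ {m} → Middle m → lookup p m ∈ Graph.vertices H
middle-∈ {G} {H} {p} {r} tG tH (_ , edge) {m} mid
  with i , j  , c , r₀≡ , r₁≡  ←
         joins-path⁻ p (Traces.edge⁻ tG (edge (Traces.edge⁺ tH (joins-path⁺ r {0F} {1F} (inj₁ refl)))))
     | j′ , l , d , r₁≡′ , r₂≡ ←
         joins-path⁻ p (Traces.edge⁻ tG (edge (Traces.edge⁺ tH (joins-path⁺ r {1F} {2F} (inj₁ refl)))))
  -- Both edges of the P₃ contain its centre, which has only one position in the simple path `p`.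
  with refl ← UniqueP.lookup-injective (Traces.simple tG) j j′ (trans (sym r₁≡) r₁≡′)
  with P₃-covers-middle i j l m c d
         (λ { refl → Fin.0≢1+n (UniqueP.lookup-injective (Traces.simple tH) 0F 2F (trans r₀≡ (sym r₂≡))) }) mid
... | inj₁ refl        = subst (_∈ Graph.vertices H) r₀≡ (Traces.vertex⁺ tH 0F)
... | inj₂ (inj₁ refl) = subst (_∈ Graph.vertices H) r₁≡ (Traces.vertex⁺ tH 1F)
... | inj₂ (inj₂ refl) = subst (_∈ Graph.vertices H) r₂≡ (Traces.vertex⁺ tH 2F)

list-lookup-injective : ∀ {xs : List ℕ} → ListUnique.Unique xs → ∀ {i j} →
                        List.lookup xs i ≡ List.lookup xs j → i ≡ j
list-lookup-injective {x ∷ xs} (x∉ ∷ u) {zero}  {zero}  eq = refl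
list-lookup-injective {x ∷ xs} (x∉ ∷ u) {zero}  {suc j} eq = ⊥-elim (All.lookup x∉ (∈-lookup j) eq)
list-lookup-injective {x ∷ xs} (x∉ ∷ u) {suc i} {zero}  eq = ⊥-elim (All.lookup x∉ (∈-lookup i) (sym eq))
list-lookup-injective {x ∷ xs} (x∉ ∷ u) {suc i} {suc j} eq = cong suc (list-lookup-injective u eq)

unique-⊆⇒length≤ : ∀ {xs ys : List ℕ} → ListUnique.Unique xs → (∀ {x} → x ∈ xs → x ∈ ys) →
                   length xs ≤ length ys
unique-⊆⇒length≤ {xs} {ys} u sub = injective⇒≤ {f = λ i → index (sub (∈-lookup i))} λ {i} {j} eq →
  list-lookup-injective u (trans (lookup-index (sub (∈-lookup i)))
    (trans (cong (List.lookup ys) eq) (sym (lookup-index (sub (∈-lookup j))))))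

-- If some x of `xs` is missing from `ys`, covering the pairs with x puts every other element into
-- `ys`, so `xs` lies within `x ∷ ys`.
unique-cover⇒length≤ : ∀ {xs ys : List ℕ} → ListUnique.Unique xs →
  (∀ {x y} → x ∈ xs → y ∈ xs → x ≢ y → x ∈ ys ⊎ y ∈ ys) → length xs ≤ suc (length ys)
unique-cover⇒length≤ {xs} {ys} u cover with All.all? (λ x → _∈?_ _≟_ x ys) xs
... | yes xs⊆ys = m≤n⇒m≤1+n (unique-⊆⇒length≤ u (All.lookup xs⊆ys))
... | no ¬xs⊆ys with x , x∈ , x∉ys ← find (AllP.¬All⇒Any¬ (λ x → _∈?_ _≟_ x ys) xs ¬xs⊆ys) =
  unique-⊆⇒length≤ u inside
  where
    inside : ∀ {y} → y ∈ xs → y ∈ x ∷ ys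
    inside {y} y∈ with y ≟ x
    ... | yes refl = here refl
    ... | no  y≢x  with cover x∈ y∈ (≢-sym y≢x)
    ...   | inj₁ x∈ys = ⊥-elim (x∉ys x∈ys)
    ...   | inj₂ y∈ys = there y∈ys

module _ (B : DesignOfOrder (P 4) v) (B′ : DesignOfOrder (P 3) n)
         (link : DownLink (DesignOfOrder.design B) (DesignOfOrder.design B′)) where
  private
    module B  = DesignOfOrder B
    module B′ = DesignOfOrder B′
    X  = VertexSet.elements B.vertexSet
    X′ = VertexSet.elements B′.vertexSet

  -- Stated for any path tracing the block, so that it also applies to the path from which a block
  -- was built.
  interior-∈ : ∀ i {p} → Traces (B.block i) p → ∀ {m} → Middle m → lookup p m ∈ X′
  interior-∈ i t mid = proj₁ (B′.subgraph (proj₁ link i))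
    (middle-∈ t (blockPath-traces B′.design (proj₁ link i)) (proj₂ link i) mid)

  -- Any two vertices of $K_v$ form an edge of some block, and one of them is an inner vertex there;
  -- hence at most one vertex is missing from $K_n$.
  linked-order : v ≤ suc n
  linked-order = subst₂ _≤_ B.order≡n (cong suc B′.order≡n)
    (unique-cover⇒length≤ (VertexSet.unique B.vertexSet) cover)
    where
      cover : ∀ {x y} → x ∈ X → y ∈ X → x ≢ y → x ∈ X′ ⊎ y ∈ X′
      cover x∈ y∈ x≢y with b , e , _ ← B.partition (x∈ , y∈ , x≢y)
        with i , j , c , refl , refl ← joins-path⁻ (blockPath B.design b)
          (Traces.edge⁻ (blockPath-traces B.design b) e) =
        Sum.map (interior-∈ b (blockPath-traces B.design b)) (interior-∈ b (blockPath-traces B.design b))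
                (edge-meets-middle i j c)

middles⁻ : ∀ Q → x ∈ middles Q → ∃₂ λ i m → Middle m × x ≡ lookup (List.lookup Q i) m
middles⁻ ((a ∷ b ∷ c ∷ d ∷ []) ∷ Q) (here refl)         = zero , 1F , inj₁ refl , refl
middles⁻ ((a ∷ b ∷ c ∷ d ∷ []) ∷ Q) (there (here refl)) = zero , 2F , inj₂ refl , refl
middles⁻ ((a ∷ b ∷ c ∷ d ∷ []) ∷ Q) (there (there x∈)) with i , m , mid , eq ← middles⁻ Q x∈ =
  suc i , m , mid , eq

-- Membership in `𝓛₂` is applied to the one design given by `Q`; as all its vertices are inner, its
-- down-link forces every label into the P₃-design.
interior-order : ∀ v n Q → All Unique Q → edges Q ≋ complete (range 0 v) → All (_∈ middles Q) (range 0 v) →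
               𝓛₂ (P 4) v n → v ≤ n
interior-order v n Q u e mid l = subst₂ _≤_ (length-range 0 v) B′.order≡n
  (unique-⊆⇒length≤ (range-unique 0 v) inside)
  where
    B : DesignOfOrder (P 4) v
    B = record { vertexSet = rangeSet 0 v ; order≡n = length-range 0 v
               ; design = toDesign (rangeSet 0 v) Q u e }
    module B′ = DesignOfOrder (proj₁ (l B))
    inside : ∀ {x} → x ∈ range 0 v → x ∈ VertexSet.elements B′.vertexSet
    inside x∈ with i , m , mid , refl ← middles⁻ Q (All.lookup mid x∈) =
      interior-∈ B (proj₁ (l B)) (proj₂ (l B)) i
        (pathGraph-traces (List.lookup Q i) (All.lookup u (∈-lookup i))) mid

interiorOrder⇒≤ : InteriorOrder v → 𝓛₂ (P 4) v n → v ≤ n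
interiorOrder⇒≤ (inj₁ (k , refl , D)) = interior-order _ _ D.Q D.simple D.full D.interior
  where module D = Interior D
interiorOrder⇒≤ (inj₂ (k , refl , D)) = interior-order _ _ D.Q D.simple D.full D.interior
  where module D = Interior D

-- For n > v every design of order v can be linked, so the given one is used.
larger-𝓛₁ : DesignOfOrder (P 4) v → ∀ m → (suc m + v) % 4 ≡ 0 ⊎ (suc m + v) % 4 ≡ 1 → 𝓛₁ (P 4) v (suc m + v)
larger-𝓛₁ record { vertexSet = X ; order≡n = refl ; design = D } =
  linkLarger X (blockPaths D) (AllP.tabulate⁺ (Traces.simple ∘ blockPath-traces D)) (edges-blockPaths D)

theorem8p1 : (v : ℕ) → 1 < v → DesignOfOrder (P 4) v →
    (𝓛₁ (P 4) v ≐ λ n → n ≥ v ∸ 1 × (n % 4 ≡ 0 ⊎ n % 4 ≡ 1)) ×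
    (𝓛₂ (P 4) v ⊆ λ n → n ≥ v × (n % 4 ≡ 0 ⊎ n % 4 ≡ 1))
theorem8p1 (suc (suc u)) (s≤s (s≤s z≤n)) B = (necessary , sufficient) , universal
  where
    necessary : ∀ {n} → 𝓛₁ (P 4) (2 + u) n → suc u ≤ n × (n % 4 ≡ 0 ⊎ n % 4 ≡ 1)
    necessary (B , B′ , f) = s≤s⁻¹ (linked-order B B′ f) , order-P₃ B′

    sufficient : ∀ {n} → suc u ≤ n × (n % 4 ≡ 0 ⊎ n % 4 ≡ 1) → 𝓛₁ (P 4) (2 + u) n
    sufficient {n} (u<n , r) with <-cmp (2 + u) n
    -- The condition modulo 3 comes from the given P₄-design, the one modulo 4 from n.
    ... | tri≈ _ refl _ = plainLinked⇒𝓛₁ (plainLinked (2 + u) (order-P₄ B) r)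
    ... | tri> _ _ n<2+u with refl ← ≤-antisym (s≤s⁻¹ n<2+u) u<n =
      pointedLinked⇒𝓛₁ (pointedLinked n (order-P₄ B) r)
    ... | tri< 2+u<n _ _ with m , refl ← m≤n⇒∃[o]m+o≡n 2+u<n =
      subst (𝓛₁ (P 4) (2 + u)) eq (larger-𝓛₁ B m (subst (λ n → n % 4 ≡ 0 ⊎ n % 4 ≡ 1) (sym eq) r))
      where
        eq : suc m + (2 + u) ≡ 3 + u + m
        eq = cong suc (+-comm m (2 + u))

    universal : ∀ {n} → 𝓛₂ (P 4) (2 + u) n → 2 + u ≤ n × (n % 4 ≡ 0 ⊎ n % 4 ≡ 1)
    -- The given design `B` turns membership in `𝓛₂` into membership in `𝓛₁`. Only n = v - 1 then
    -- remains to be excluded, by a design all of whose vertices are inner.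
    universal {n} l with necessary (B , l B) | 2 + u ≤? n
    ... | _   , r | yes 2+u≤n = 2+u≤n , r
    ... | u<n , r | no  2+u≰n with refl ← ≤-antisym (s≤s⁻¹ (≰⇒> 2+u≰n)) u<n =
      interiorOrder⇒≤ (interiorOrder u (order-P₄ B) r) l , r
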